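{- Let $\mathbf{Q}=(L,Q_1,Q_2,\ldots,Q_n,R)$ be a $(4,2)$-flexipath in a matroid $M$, where $n\ge 2$. Then: (i) If $\mathbf{Q}$ has no specially placed steps, then either (a) $\mathbf{Q}$ is squashed, stretched, paddle-reminiscent, or spike-reminiscent; or (b) $n=3$ and, in either $M$ or $M^*$, $\mathbf{Q}$ is prism-like, tightened-prism-like, doubly-tightened-prism-like, relaxed-spike-reminiscent, Vámos-inspired, or nasty; or (c) $n=2$ and $\sqcap(Q_1,Q_2)=0=\sqcap^*(Q_1,Q_2)$, while $\sqcap(L,R)=1=\sqcap^*(L,R)$. (ii) If $Q_n$ is a specially placed step of type (S1) and $n\ge 3$, then $(L,Q_1,\ldots,Q_{n-1},Q_n\cup R)$ is paddle-reminiscent or relaxed-paddle-reminiscent. (iii) If $Q_n$ is a specially placed step of type (S2) and $n\ge 3$, then $(L,Q_1,\ldots,Q_{n-1},Q_n\cup R)$ is spike-reminiscent or relaxed-spike-reminiscent.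
   Context: Let $M$ be a matroid on ground set $E$ with rank function $r$. For $A\subseteq E$, $\lambda(A)=r(A)+r(E-A)-r(M)$. For disjoint $X,Y\subseteq E$, $\sqcap(X,Y)=r(X)+r(Y)-r(X\cup Y)$ and $\sqcap^*(X,Y)$ is the same quantity computed in $M^*$; "in $M^*$" below means all conditions are evaluated with $M^*$ in place of $M$ (so $\sqcap$ and $\sqcap^*$ swap roles). $\kappa(X,Y)=\min\{\lambda(Z): X\subseteq Z\subseteq E-Y\}$. A path of $4$-separations is an ordered partition $(L,P_1,\ldots,P_n,R)$ of $E$ with $\kappa(L,R)=3$ and $\lambda(L\cup P_1\cup\cdots\cup P_i)=3$ for all $i\in\{0,\ldots,n\}$; it is a $4$-flexipath if this holds for every reordering of $P_1,\ldots,P_n$ (with $L,R$ fixed); it is a $(4,c)$-flexipath if moreover $\lambda(P_i)=c$ for all $i$ and $\lambda(P_i\cup P_j)>c$ for all distinct $i,j$. For a $(4,2)$-flexipath $\mathbf{Q}=(L,Q_1,\ldots,Q_n,R)$: $Q_i$ is a specially placed step of type (S1) if $\sqcap(L,R)=2$ and $\sqcap(L,Q_i)=2=\sqcap(R,Q_i)$; of type (S2) if $\sqcap^*(L,R)=2$ and $\sqcap^*(L,Q_i)=2=\sqcap^*(R,Q_i)$. Condition (B): $\sqcap(Q_i,L)=\sqcap(Q_i,R)=\sqcap^*(Q_i,L)=\sqcap^*(Q_i,R)=1$ for all $i\in[n]$. Below, "pairs $(a,b)$" means $\sqcap(Q_i,Q_j)=a$ and $\sqcap^*(Q_i,Q_j)=b$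 for all distinct $i,j\in[n]$, and "$(L,R)$ is $(a,b)$" means $\sqcap(L,R)=a$, $\sqcap^*(L,R)=b$. - spike-reminiscent: $(L,R)$ is $(1,2)$, pairs $(1,0)$, (B). - paddle-reminiscent: $(L,R)$ is $(2,1)$, pairs $(0,1)$, (B). - squashed: $(L,R)$ is $(3,0)$, pairs $(1,0)$, $\sqcap(Q_i,L)=\sqcap(Q_i,R)=2$ and $\sqcap^*(Q_i,L)=\sqcap^*(Q_i,R)=0$ for all $i$. - stretched: $(L,R)$ is $(0,3)$, pairs $(0,1)$, $\sqcap(Q_i,L)=\sqcap(Q_i,R)=0$ and $\sqcap^*(Q_i,L)=\sqcap^*(Q_i,R)=2$ for all $i$. - relaxed-spike-reminiscent: $n=3$, $(L,R)$ is $(0,2)$, pairs $(1,0)$, (B). - relaxed-paddle-reminiscent: $n=3$, $(L,R)$ is $(2,0)$, pairs $(0,1)$, (B). - prism-like: $n=3$, pairs $(0,0)$, $(L,R)$ is $(0,0)$, (B). - tightened-prism-like: $n=3$, pairs $(0,0)$, $(L,R)$ is $(0,1)$, (B). - doubly-tightened-prism-like: $n=3$, pairs $(0,0)$, $(L,R)$ is $(1,1)$, (B). - Vámos-inspired: in either $M$ or $M^*$: $n=3$, $(L,R)$ is $(0,1)$, (B), $\sqcap^*(Q_i,Q_j)=0$ for all distinct $i,j$, and after a permutation of $\{1,2,3\}$, $\sqcap(Q_1,Q_2)=0=\sqcap(Q_1,Q_3)$ and $\sqcap(Q_2,Q_3)=1$. - nasty: $n=3$, $(L,R)$ is $(1,1)$,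 (B), and after a permutation of $\{1,2,3\}$ the triple $\big((\sqcap(Q_1,Q_2),\sqcap^*(Q_1,Q_2)),(\sqcap(Q_1,Q_3),\sqcap^*(Q_1,Q_3)),(\sqcap(Q_2,Q_3),\sqcap^*(Q_2,Q_3))\big)$ is one of $((0,0),(0,1),(1,0))$, $((0,0),(0,0),(1,0))$, $((0,0),(0,0),(0,1))$. -}

module Defs where

open import Data.Nat using (ℕ; zero; suc; _+_; _∸_; _≤_; _<_)
open import Data.Fin using (Fin; zero; suc; toℕ; inject₁; fromℕ)
open import Data.Fin.Subset using (Subset; _∪_; _∩_; ∁; ⊤; ⊥; ∣_∣; _⊆_; _∈_)
open import Data.Fin.Permutation using (Permutation′; _⟨$⟩ʳ_)
open import Data.Product using (_×_; Σ; ∃; ∃-syntax; _,_)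
open import Data.Sum using (_⊎_)
open import Data.Empty using ()
open import Relation.Nullary using (¬_)
open import Relation.Binary.PropositionalEquality using (_≡_; _≢_)

record Matroid (m : ℕ) : Set where
  field
    rank      : Subset m → ℕ
    rank-≤-∣∣ : ∀ X → rank X ≤ ∣ X ∣
    rank-mono : ∀ {X Y} → X ⊆ Y → rank X ≤ rank Y
    rank-sub  : ∀ X Y → rank (X ∪ Y) + rank (X ∩ Y) ≤ rank X + rank Y

-- A rank function on E = Fin m (the quantities below only depend on it).
RankFn : ℕ → Set
RankFn m = Subset m → ℕ

module _ {m : ℕ} where

  -- rank function of the dual matroid: r*(X) = |X| + r(E - X) - r(E)
  -- (never truncated for a matroid rank function)
  dualRank : RankFn m → RankFn m
  dualRank r X = ∣ X ∣ + r (∁ X) ∸ r ⊤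

  conn : RankFn m → Subset m → ℕ
  conn r A = r A + r (∁ A) ∸ r ⊤

  lc : RankFn m → Subset m → Subset m → ℕ
  lc r X Y = r X + r Y ∸ r (X ∪ Y)

  lc* : RankFn m → Subset m → Subset m → ℕ
  lc* r = lc (dualRank r)

  KappaIs : RankFn m → Subset m → Subset m → ℕ → Set
  KappaIs r X Y k =
    (∃[ Z ] (X ⊆ Z × Z ⊆ ∁ Y × conn r Z ≡ k)) ×
    (∀ Z → X ⊆ Z → Z ⊆ ∁ Y → k ≤ conn r Z)

  Disjoint : Subset m → Subset m → Set
  Disjoint X Y = ∀ {e} → e ∈ X → e ∈ Y → Data.Empty.⊥

  unionUpTo : ∀ {n} → (Fin n → Subset m) → ℕ → Subset m
  unionUpTo {zero}  Q i       = ⊥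
  unionUpTo {suc n} Q zero    = ⊥
  unionUpTo {suc n} Q (suc i) = Q zero ∪ unionUpTo (λ j → Q (suc j)) i

  IsOrderedPartition : ∀ {n} → Subset m → (Fin n → Subset m) → Subset m → Set
  IsOrderedPartition {n} L Q R =
    Disjoint L R ×
    (∀ i → Disjoint L (Q i)) ×
    (∀ i → Disjoint (Q i) R) ×
    (∀ i j → i ≢ j → Disjoint (Q i) (Q j)) ×
    (⊤ ⊆ (L ∪ (unionUpTo Q n ∪ R)))

  IsPath4 : ∀ {n} → RankFn m → Subset m → (Fin n → Subset m) → Subset m → Set
  IsPath4 {n} r L Q R =
    IsOrderedPartition L Q R ×
    KappaIs r L R 3 ×
    (∀ i → i ≤ n → conn r (L ∪ unionUpTo Q i) ≡ 3)

  Is4Flexipath : ∀ {n} → RankFn m → Subset m → (Fin n → Subset m) → Subset m → Set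
  Is4Flexipath {n} r L Q R =
    (π : Permutation′ n) → IsPath4 r L (λ i → Q (π ⟨$⟩ʳ i)) R

  Is4cFlexipath : ∀ {n} → ℕ → RankFn m → Subset m → (Fin n → Subset m) → Subset m → Set
  Is4cFlexipath {n} c r L Q R =
    Is4Flexipath r L Q R ×
    (∀ i → conn r (Q i) ≡ c) ×
    (∀ i j → i ≢ j → c < conn r (Q i ∪ Q j))

  SpeciallyPlacedS1 : ∀ {n} → RankFn m → Subset m → (Fin n → Subset m) → Subset m → Fin n → Set
  SpeciallyPlacedS1 r L Q R i =
    lc r L R ≡ 2 × lc r L (Q i) ≡ 2 × lc r R (Q i) ≡ 2

  SpeciallyPlacedS2 : ∀ {n} → RankFn m → Subset m → (Fin n → Subset m) → Subset m → Fin n → Set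
  SpeciallyPlacedS2 r L Q R i =
    lc* r L R ≡ 2 × lc* r L (Q i) ≡ 2 × lc* r R (Q i) ≡ 2

  LRis : RankFn m → Subset m → Subset m → ℕ → ℕ → Set
  LRis r L R a b = lc r L R ≡ a × lc* r L R ≡ b

  PairIs : ∀ {n} → RankFn m → (Fin n → Subset m) → Fin n → Fin n → ℕ → ℕ → Set
  PairIs r Q i j a b = lc r (Q i) (Q j) ≡ a × lc* r (Q i) (Q j) ≡ b

  Pairs : ∀ {n} → RankFn m → (Fin n → Subset m) → ℕ → ℕ → Set
  Pairs r Q a b = ∀ i j → i ≢ j → PairIs r Q i j a b

  CondB : ∀ {n} → RankFn m → Subset m → (Fin n → Subset m) → Subset m → Set
  CondB r L Q R = ∀ i →
    lc r (Q i) L ≡ 1 × lc r (Q i) R ≡ 1 × lc* r (Q i) L ≡ 1 × lc* r (Q i) R ≡ 1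

  Distinct3 : ∀ {n} → Fin n → Fin n → Fin n → Set
  Distinct3 i j k = i ≢ j × i ≢ k × j ≢ k

  PathPred : Set₁
  PathPred = ∀ {n} → RankFn m → Subset m → (Fin n → Subset m) → Subset m → Set

  SpikeReminiscent : PathPred
  SpikeReminiscent r L Q R = LRis r L R 1 2 × Pairs r Q 1 0 × CondB r L Q R

  PaddleReminiscent : PathPred
  PaddleReminiscent r L Q R = LRis r L R 2 1 × Pairs r Q 0 1 × CondB r L Q R

  Squashed : PathPred
  Squashed r L Q R = LRis r L R 3 0 × Pairs r Q 1 0 ×
    (∀ i → lc r (Q i) L ≡ 2 × lc r (Q i) R ≡ 2 × lc* r (Q i) L ≡ 0 × lc* r (Q i) R ≡ 0)

  Stretched : PathPred
  Stretched r L Q R = LRis r L R 0 3 × Pairs r Q 0 1 ×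
    (∀ i → lc r (Q i) L ≡ 0 × lc r (Q i) R ≡ 0 × lc* r (Q i) L ≡ 2 × lc* r (Q i) R ≡ 2)

  RelaxedSpikeReminiscent : PathPred
  RelaxedSpikeReminiscent {n} r L Q R =
    n ≡ 3 × LRis r L R 0 2 × Pairs r Q 1 0 × CondB r L Q R

  RelaxedPaddleReminiscent : PathPred
  RelaxedPaddleReminiscent {n} r L Q R =
    n ≡ 3 × LRis r L R 2 0 × Pairs r Q 0 1 × CondB r L Q R

  PrismLike : PathPred
  PrismLike {n} r L Q R = n ≡ 3 × Pairs r Q 0 0 × LRis r L R 0 0 × CondB r L Q R

  TightenedPrismLike : PathPred
  TightenedPrismLike {n} r L Q R = n ≡ 3 × Pairs r Q 0 0 × LRis r L R 0 1 × CondB r L Q R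

  DoublyTightenedPrismLike : PathPred
  DoublyTightenedPrismLike {n} r L Q R = n ≡ 3 × Pairs r Q 0 0 × LRis r L R 1 1 × CondB r L Q R

  VamosCond : PathPred
  VamosCond {n} r L Q R =
    n ≡ 3 × LRis r L R 0 1 × CondB r L Q R ×
    (∀ i j → i ≢ j → lc* r (Q i) (Q j) ≡ 0) ×
    (∃[ i ] ∃[ j ] ∃[ k ] (Distinct3 i j k ×
        lc r (Q i) (Q j) ≡ 0 × lc r (Q i) (Q k) ≡ 0 × lc r (Q j) (Q k) ≡ 1))

  VamosInspired : PathPred
  VamosInspired r L Q R = VamosCond r L Q R ⊎ VamosCond (dualRank r) L Q R

  Nasty : PathPred
  Nasty {n} r L Q R =
    n ≡ 3 × LRis r L R 1 1 × CondB r L Q R ×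
    (∃[ i ] ∃[ j ] ∃[ k ] (Distinct3 i j k ×
        ((PairIs r Q i j 0 0 × PairIs r Q i k 0 1 × PairIs r Q j k 1 0) ⊎
         (PairIs r Q i j 0 0 × PairIs r Q i k 0 0 × PairIs r Q j k 1 0) ⊎
         (PairIs r Q i j 0 0 × PairIs r Q i k 0 0 × PairIs r Q j k 0 1))))

  InMOrDual : PathPred → PathPred
  InMOrDual P r L Q R = P r L Q R ⊎ P (dualRank r) L Q R

  initSteps : ∀ {k} → (Fin (suc k) → Subset m) → Fin k → Subset m
  initSteps Q i = Q (inject₁ i)

  lastStep : ∀ {k} → (Fin (suc k) → Subset m) → Subset m
  lastStep {k} Q = Q (fromℕ k)

lastStepIx : (k : ℕ) → Fin (suc k)
lastStepIx k = fromℕ k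

{-# OPTIONS --safe #-}
-- For S ⊆ [n] let Q_S be the union of the Qᵢ with i ∈ S. Flexibility says that
-- r(L ∪ Q_S) + r(R ∪ Q_{[n]−S}) does not depend on S; both terms are submodular in S, so both
-- are modular. Hence G(S) = ⊓(L,Q_S) = ⊓(R,Q_S) and K(S) = ⊓*(L,Q_S) are polymatroids on [n],
-- exchanged by duality, with G(S) + K(S) = λ(Q_S), G(A) + K(B) ≤ 3 for disjoint A and B,
-- ⊓(L,R) = 3 − K([n]), ⊓*(L,R) = 3 − G([n]) and ⊓(Qᵢ,Qⱼ) = G(i) + G(j) − G(ij). The theorem is
-- a classification of such pairs (G, K).
--
-- If G(i) = 2 for some i, then K ≤ 1; so K([n]) = 1 and Qᵢ is specially placed, or K = 0 and the
-- path is squashed. Otherwise G(i) = K(i) = 1 for all i, and two steps are parallel in G,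
-- parallel in K, or skew in both. If n ≥ 4, there are no skew pairs, so two equivalence relations
-- cover all pairs and one of them is total. If n ≤ 3, the few configurations are inspected.
module Submission where

open import Defs
import Algebra.Lattice.Properties.BooleanAlgebra as BooleanAlgebraProperties
open import Data.Bool using (true; false)
open import Data.Fin using (Fin; zero; suc; toℕ; fromℕ; inject₁; punchIn; punchOut)
open import Data.Fin.Patterns using (0F; 1F; 2F)
open import Data.Fin.Permutation using (Permutation′; _⟨$⟩ʳ_; id; lift₀; insert; insert-punchIn)
open import Data.Fin.Properties
  using (toℕ-inject₁; toℕ-fromℕ; inject₁-injective; fromℕ≢inject₁; any?; punchIn-punchOut; punchInᵢ≢i; punchIn-injective)
  renaming (suc-injective to Fin-suc-injective; _≟_ to _≟ᶠ_)
open import Data.Fin.Relation.Unary.Top using (View; view; ‵fromℕ; ‵inj₁)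
open import Data.Fin.Subset
open import Data.Fin.Subset.Properties
open import Data.Nat using (ℕ; zero; suc; _+_; _∸_; _≤_; _<_; z≤n; s≤s; z<s; s<s; _≟_)
open import Data.Nat.Properties
open import Data.Nat.Tactic.RingSolver using (solve)
open import Data.Product using (_×_; _,_; proj₁; proj₂; ∃)
open import Data.Sum using (_⊎_; inj₁; inj₂; [_,_]′)
open import Function using (_∘_)
open import Relation.Nullary using (¬_; yes; no; contradiction)
open import Relation.Binary.PropositionalEquality

-- Linear arithmetic over the natural numbers

module _ {x y p q : ℕ} (x+q≡y+p : x + q ≡ y + p) where

  -- Here `p` and `q` are the sums of the left and right sides of the relations being combined, so
  -- the ring solver only has to check `x + q ≡ y + p`, and truncated subtraction never appears.
  combine-≡ : p ≡ q → x ≡ y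
  combine-≡ refl = +-cancelʳ-≡ p x y x+q≡y+p

  combine-≤ : p ≤ q → x ≤ y
  combine-≤ p≤q = +-cancelʳ-≤ q x y (≤-trans (≤-reflexive x+q≡y+p) (+-monoʳ-≤ y p≤q))

-- In each of these lemmas, adding up the hypotheses in suitable directions and cancelling gives
-- the conclusion.
module _ where

  open import Data.List using ([]; _∷_)

  ∁-arith : ∀ x y d a b → x + d ≤ y → a ≤ b + d → x + a ≤ y + b
  ∁-arith x y d a b p q = combine-≤ {p = (x + d) + a} {q = y + (b + d)}
    (solve (x ∷ y ∷ d ∷ a ∷ b ∷ [])) (+-mono-≤ p q)

  dual-≤-arith : ∀ d c t a → d + t ≡ c + a → a ≤ t → d ≤ c
  dual-≤-arith d c t a e a≤t =
    combine-≤ {p = (d + t) + a} {q = (c + a) + t} (solve (d ∷ c ∷ t ∷ a ∷ []))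
      (+-mono-≤ (≤-reflexive e) a≤t)

  dual-sub-arith : ∀ x y u i t cx cy cu ci a b w j →
    x + t ≡ cx + a → y + t ≡ cy + b → u + t ≡ cu + w → i + t ≡ ci + j →
    cu + ci ≡ cx + cy → j + w ≤ a + b → u + i ≤ x + y
  dual-sub-arith x y u i t cx cy cu ci a b w j ex ey eu ei ec le =
    combine-≤
      {p = ((cx + a) + (cy + b)) + ((u + t) + (i + t)) + (cu + ci) + (j + w)}
      {q = ((x + t) + (y + t)) + ((cu + w) + (ci + j)) + (cx + cy) + (a + b)}
      (solve (x ∷ y ∷ u ∷ i ∷ t ∷ cx ∷ cy ∷ cu ∷ ci ∷ a ∷ b ∷ w ∷ j ∷ []))
      (+-mono-≤ (≤-reflexive
        (cong₂ _+_ (cong₂ _+_ (sym (cong₂ _+_ ex ey)) (cong₂ _+_ eu ei)) ec)) le)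

  involutive-arith : ∀ d s t u x {c} e {z} a {b} → d + s ≡ x + u → s + t ≡ c + z → u + t ≡ e + b →
    x + e ≡ c → z ≡ 0 → b ≡ a → d ≡ a
  involutive-arith d s t u x e a e₁ e₂ e₃ refl refl refl =
    combine-≡ {p = (d + s) + (x + e + 0) + (u + t)} {q = (x + u) + (s + t) + (e + a)}
      (solve (d ∷ s ∷ t ∷ u ∷ x ∷ e ∷ a ∷ []))
      (cong₂ _+_ (cong₂ _+_ e₁ (sym e₂)) e₃)

  lc-mono-arith : ∀ l k u v x y z → l + u ≡ x + y → k + v ≡ x + z → v + y ≤ u + z → l ≤ k
  lc-mono-arith l k u v x y z e₁ e₂ le =
    combine-≤ {p = (l + u) + (x + z) + (v + y)} {q = (x + y) + (k + v) + (u + z)}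
      (solve (l ∷ k ∷ u ∷ v ∷ x ∷ y ∷ z ∷ []))
      (+-mono-≤ (≤-reflexive (cong₂ _+_ e₁ (sym e₂))) le)

  lc*-arith : ∀ l u x y t cx cy cu a b w → l + u ≡ x + y →
    x + t ≡ cx + a → y + t ≡ cy + b → u + t ≡ cu + w → cu ≡ cx + cy → l + t + w ≡ a + b
  lc*-arith l u x y t cx cy _ a b w e ex ey eu refl =
    combine-≡
      {p = (l + u) + (x + t) + (y + t) + ((cx + cy) + w)}
      {q = (x + y) + (cx + a) + (cy + b) + (u + t)}
      (solve (l ∷ u ∷ x ∷ y ∷ t ∷ cx ∷ cy ∷ a ∷ b ∷ w ∷ []))
      (cong₂ _+_ (cong₂ _+_ (cong₂ _+_ e ex) ey) (sym eu))

  conn-dual-arith : ∀ k k* s t x y c e a b {u z} → k + t ≡ b + a → k* + s ≡ x + y →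
    x + t ≡ c + a → y + t ≡ e + b → s + t ≡ u + z → c + e ≡ u → z ≡ 0 → k* ≡ k
  conn-dual-arith k k* s t x y c e a b ek ek* ex ey es refl refl =
    combine-≡
      {p = (b + a) + (k* + s) + (x + t) + (y + t) + (c + e + 0)}
      {q = (k + t) + (x + y) + (c + a) + (e + b) + (s + t)}
      (solve (k ∷ k* ∷ s ∷ t ∷ x ∷ y ∷ c ∷ e ∷ a ∷ b ∷ []))
      (cong₂ _+_ (cong₂ _+_ (cong₂ _+_ (cong₂ _+_ (sym ek) ek*) ex) ey) (sym es))

  modular-arith : ∀ w aS aT au ai bS bT bu bi → aS + bS ≡ w → aT + bT ≡ w → au + bi ≡ w →
    ai + bu ≡ w → bu + bi ≤ bS + bT → aS + aT ≤ au + ai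
  modular-arith w aS aT au ai bS bT bu bi eS eT eu ei le =
    combine-≤
      {p = (aS + bS) + (aT + bT) + w + w + (bu + bi)} {q = w + w + (au + bi) + (ai + bu) + (bS + bT)}
      (solve (w ∷ aS ∷ aT ∷ au ∷ ai ∷ bS ∷ bT ∷ bu ∷ bi ∷ []))
      (+-mono-≤ (≤-reflexive (cong₂ _+_ (cong₂ _+_ (cong₂ _+_ eS eT) (sym eu)) (sym ei))) le)

  A-B-arith : ∀ w aS a∁ a⊤ a⊥ bS b⊥ → aS + a∁ ≡ a⊤ + a⊥ → a∁ + bS ≡ w → a⊤ + b⊥ ≡ w →
    aS + b⊥ ≡ bS + a⊥
  A-B-arith w aS a∁ a⊤ a⊥ bS b⊥ e₁ e₂ e₃ =
    combine-≡ {p = (aS + a∁) + w + (a⊤ + b⊥)} {q = (a⊤ + a⊥) + (a∁ + bS) + w}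
      (solve (w ∷ aS ∷ a∁ ∷ a⊤ ∷ a⊥ ∷ bS ∷ b⊥ ∷ []))
      (cong₂ _+_ (cong₂ _+_ e₁ (sym e₂)) e₃)

  G-sub-arith : ∀ GS GT Gu Gi aS aT au ai gS gT gu gi a → GS + aS ≡ a + gS → GT + aT ≡ a + gT →
    Gu + au ≡ a + gu → Gi + ai ≡ a + gi → au + ai ≡ aS + aT → gu + gi ≤ gS + gT → Gu + Gi ≤ GS + GT
  G-sub-arith GS GT Gu Gi aS aT au ai gS gT gu gi a eS eT eu ei ea le =
    combine-≤
      {p = (a + gS) + (a + gT) + (Gu + au) + (Gi + ai) + (aS + aT) + (gu + gi)}
      {q = (GS + aS) + (GT + aT) + (a + gu) + (a + gi) + (au + ai) + (gS + gT)}
      (solve (GS ∷ GT ∷ Gu ∷ Gi ∷ aS ∷ aT ∷ au ∷ ai ∷ gS ∷ gT ∷ gu ∷ gi ∷ a ∷ []))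
      (+-mono-≤ (≤-reflexive
        (cong₂ _+_ (cong₂ _+_ (cong₂ _+_ (cong₂ _+_ (sym eS) (sym eT)) eu) ei) (sym ea))) le)

  G-R-arith : ∀ l G aS bS a b g → l + bS ≡ b + g → G + aS ≡ a + g → aS + b ≡ bS + a → l ≡ G
  G-R-arith l G aS bS a b g e₁ e₂ e₃ =
    combine-≡ {p = (l + bS) + (a + g) + (aS + b)} {q = (b + g) + (G + aS) + (bS + a)}
      (solve (l ∷ G ∷ aS ∷ bS ∷ a ∷ b ∷ g ∷ []))
      (cong₂ _+_ (cong₂ _+_ e₁ (sym e₂)) e₃)

  G-pair-arith : ∀ l GS GT Gu aS aT au a gS gT gu → l + gu ≡ gS + gT → Gu + au ≡ a + gu →
    GS + aS ≡ a + gS → GT + aT ≡ a + gT → au + a ≡ aS + aT → l + Gu ≡ GS + GT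
  G-pair-arith l GS GT Gu aS aT au a gS gT gu e₁ e₂ e₃ e₄ e₅ =
    combine-≡
      {p = (l + gu) + (Gu + au) + (a + gS) + (a + gT) + (aS + aT)}
      {q = (gS + gT) + (a + gu) + (GS + aS) + (GT + aT) + (au + a)}
      (solve (l ∷ GS ∷ GT ∷ Gu ∷ aS ∷ aT ∷ au ∷ a ∷ gS ∷ gT ∷ gu ∷ []))
      (cong₂ _+_ (cong₂ _+_ (cong₂ _+_ (cong₂ _+_ e₁ e₂) (sym e₃)) (sym e₄)) (sym e₅))

  cross-arith : ∀ G K t a a⊥ b b⊤ g h → G + a ≡ a⊥ + g → K + t + b ≡ b⊤ + h → a⊥ + b⊤ ≡ 3 + t →
    h + g ≤ a + b → G + K ≤ 3
  cross-arith G K t a a⊥ b b⊤ g h e₁ e₂ e₃ le =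
    combine-≤
      {p = (G + a) + (K + t + b) + (a⊥ + b⊤) + (h + g)} {q = (a⊥ + g) + (b⊤ + h) + (3 + t) + (a + b)}
      (solve (G ∷ K ∷ t ∷ a ∷ a⊥ ∷ b ∷ b⊤ ∷ g ∷ h ∷ []))
      (+-mono-≤ (≤-reflexive (cong₂ _+_ (cong₂ _+_ e₁ e₂) e₃)) le)

  LR-arith : ∀ l K t a⊥ b⊤ b⊥ h → l + h ≡ a⊥ + b⊥ → K + t + b⊥ ≡ b⊤ + h → a⊥ + b⊤ ≡ 3 + t → l + K ≡ 3
  LR-arith l K t a⊥ b⊤ b⊥ h e₁ e₂ e₃ =
    combine-≡ {p = (l + h) + (K + t + b⊥) + (a⊥ + b⊤)} {q = (a⊥ + b⊥) + (b⊤ + h) + (3 + t)}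
      (solve (l ∷ K ∷ t ∷ a⊥ ∷ b⊤ ∷ b⊥ ∷ h ∷ []))
      (cong₂ _+_ (cong₂ _+_ e₁ e₂) e₃)

  LR*-arith : ∀ l G t a⊤ a⊥ b⊤ g → l + t + g ≡ b⊤ + a⊤ → G + a⊤ ≡ a⊥ + g → a⊥ + b⊤ ≡ 3 + t → l + G ≡ 3
  LR*-arith l G t a⊤ a⊥ b⊤ g e₁ e₂ e₃ =
    combine-≡ {p = (l + t + g) + (G + a⊤) + (a⊥ + b⊤)} {q = (b⊤ + a⊤) + (a⊥ + g) + (3 + t)}
      (solve (l ∷ G ∷ t ∷ a⊤ ∷ a⊥ ∷ b⊤ ∷ g ∷ []))
      (cong₂ _+_ (cong₂ _+_ e₁ e₂) e₃)

  conn-arith : ∀ G K k t a a⊥ b b⊤ g h → G + a ≡ a⊥ + g → K + t + b ≡ b⊤ + h → a⊥ + b⊤ ≡ 3 + t →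
    a + b ≡ 3 + t → k + t ≡ g + h → G + K ≡ k
  conn-arith G K k t a a⊥ b b⊤ g h e₁ e₂ e₃ e₄ e₅ =
    combine-≡
      {p = (G + a) + (K + t + b) + (a⊥ + b⊤) + (3 + t) + (g + h)}
      {q = (a⊥ + g) + (b⊤ + h) + (3 + t) + (a + b) + (k + t)}
      (solve (G ∷ K ∷ k ∷ t ∷ a ∷ a⊥ ∷ b ∷ b⊤ ∷ g ∷ h ∷ []))
      (cong₂ _+_ (cong₂ _+_ (cong₂ _+_ (cong₂ _+_ e₁ e₂) e₃) (sym e₄)) (sym e₅))

open import Data.Vec using ([]; _∷_; here; there; _∷ʳ_)

-- Submodularity and duality

∣∪∣+∣∩∣ : ∀ {m} (X Y : Subset m) → ∣ X ∪ Y ∣ + ∣ X ∩ Y ∣ ≡ ∣ X ∣ + ∣ Y ∣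
∣∪∣+∣∩∣ []          []          = refl
∣∪∣+∣∩∣ (true ∷ X)  (true ∷ Y)  = cong suc (trans (+-suc _ _) (trans (cong suc (∣∪∣+∣∩∣ X Y)) (sym (+-suc _ _))))
∣∪∣+∣∩∣ (true ∷ X)  (false ∷ Y) = cong suc (∣∪∣+∣∩∣ X Y)
∣∪∣+∣∩∣ (false ∷ X) (true ∷ Y)  = trans (cong suc (∣∪∣+∣∩∣ X Y)) (sym (+-suc _ _))
∣∪∣+∣∩∣ (false ∷ X) (false ∷ Y) = ∣∪∣+∣∩∣ X Y

module _ {m : ℕ} where
  open BooleanAlgebraProperties (∪-∩-booleanAlgebra m) public
    using () renaming (¬-involutive to ∁-involutive; ¬⊤≈⊥ to ∁⊤≡⊥; ¬⊥≈⊤ to ∁⊥≡⊤; deMorgan₁ to ∁-∩; deMorgan₂ to ∁-∪)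

⁅⁆-∩ : ∀ {n} {i j : Fin n} → i ≢ j → ⁅ i ⁆ ∩ ⁅ j ⁆ ≡ ⊥
⁅⁆-∩ {i = i} {j} i≢j = Empty-unique λ (k , k∈) → i≢j
  (trans (sym (x∈⁅y⁆⇒x≡y i (p∩q⊆p ⁅ i ⁆ ⁅ j ⁆ k∈))) (x∈⁅y⁆⇒x≡y j (p∩q⊆q ⁅ i ⁆ ⁅ j ⁆ k∈)))

Submodular : ∀ {m} → (Subset m → ℕ) → Set
Submodular f = ∀ X Y → f (X ∪ Y) + f (X ∩ Y) ≤ f X + f Y

Monotone : ∀ {m} → (Subset m → ℕ) → Set
Monotone f = ∀ {X Y} → X ⊆ Y → f X ≤ f Y

module _ {m} (f : RankFn m) where

  lc-comm : ∀ X Y → lc f X Y ≡ lc f Y X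
  lc-comm X Y = cong₂ _∸_ (+-comm (f X) (f Y)) (cong f (∪-comm X Y))

  module _ (f-sub : Submodular f) where

    lc-spec : ∀ X Y → lc f X Y + f (X ∪ Y) ≡ f X + f Y
    lc-spec X Y = m∸n+n≡m (m+n≤o⇒m≤o (f (X ∪ Y)) (f-sub X Y))

    -- Submodularity for `X ∪ Y` and `Z`: their union contains `X ∪ Z` and their intersection
    -- contains `Y`.
    lc-monoʳ : Monotone f → ∀ X {Y Z} → Y ⊆ Z → lc f X Y ≤ lc f X Z
    lc-monoʳ f-mono X {Y} {Z} Y⊆Z =
      lc-mono-arith (lc f X Y) (lc f X Z) (f (X ∪ Y)) (f (X ∪ Z)) (f X) (f Y) (f Z)
        (lc-spec X Y) (lc-spec X Z)
        (≤-trans (+-mono-≤ (f-mono X∪Z⊆) (f-mono Y⊆)) (f-sub (X ∪ Y) Z))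
      where
      X∪Z⊆ : X ∪ Z ⊆ (X ∪ Y) ∪ Z
      X∪Z⊆ e∈ with x∈p∪q⁻ X Z e∈
      ... | inj₁ e∈X = x∈p∪q⁺ (inj₁ (x∈p∪q⁺ (inj₁ e∈X)))
      ... | inj₂ e∈Z = x∈p∪q⁺ (inj₂ e∈Z)
      Y⊆ : Y ⊆ (X ∪ Y) ∩ Z
      Y⊆ e∈Y = x∈p∩q⁺ (x∈p∪q⁺ (inj₂ e∈Y) , Y⊆Z e∈Y)

open Matroid

module _ {m : ℕ} (M : Matroid m) where

  private r = rank M

  rank-⊥ : r ⊥ ≡ 0
  rank-⊥ = n≤0⇒n≡0 (≤-trans (rank-≤-∣∣ M ⊥) (≤-reflexive (∣⊥∣≡0 m)))

  rank-⊤≤ : ∀ X → r ⊤ ≤ r X + r (∁ X)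
  rank-⊤≤ X = subst (λ Y → r Y ≤ r X + r (∁ X)) (p∪∁p≡⊤ X) (m+n≤o⇒m≤o _ (rank-sub M X (∁ X)))

  dualRank-spec : ∀ X → dualRank r X + r ⊤ ≡ ∣ X ∣ + r (∁ X)
  dualRank-spec X = m∸n+n≡m (≤-trans (rank-⊤≤ X) (+-monoˡ-≤ _ (rank-≤-∣∣ M X)))

  conn-spec : ∀ X → conn r X + r ⊤ ≡ r X + r (∁ X)
  conn-spec X = m∸n+n≡m (rank-⊤≤ X)

  -- Monotonicity of the dual rank before `r ⊤` is subtracted. Passing from `X` to `Y` adds `∣ D ∣`
  -- elements with `D = Y ∩ ∁ X`, and deleting `D` from `∁ X` lowers the rank by at most `∣ D ∣`.
  rank-∁-≤ : ∀ {X Y} → X ⊆ Y → ∣ X ∣ + r (∁ X) ≤ ∣ Y ∣ + r (∁ Y)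
  rank-∁-≤ {X} {Y} X⊆Y = ∁-arith (∣ X ∣) (∣ Y ∣) (∣ D ∣) (r (∁ X)) (r (∁ Y)) X+D≤Y r∁X≤
    where
    D = Y ∩ ∁ X
    X∪D⊆Y : X ∪ D ⊆ Y
    X∪D⊆Y e∈ with x∈p∪q⁻ X D e∈
    ... | inj₁ e∈X = X⊆Y e∈X
    ... | inj₂ e∈D = p∩q⊆p Y (∁ X) e∈D
    X∩D≡⊥ : X ∩ D ≡ ⊥
    X∩D≡⊥ = Empty-unique λ (e , e∈) →
      x∈p⇒x∉∁p (p∩q⊆p X D e∈) (p∩q⊆q Y (∁ X) (p∩q⊆q X D e∈))
    X+D≤Y : ∣ X ∣ + ∣ D ∣ ≤ ∣ Y ∣
    X+D≤Y = begin
      ∣ X ∣ + ∣ D ∣         ≡⟨ ∣∪∣+∣∩∣ X D ⟨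
      ∣ X ∪ D ∣ + ∣ X ∩ D ∣ ≡⟨ cong (∣ X ∪ D ∣ +_) (trans (cong ∣_∣ X∩D≡⊥) (∣⊥∣≡0 m)) ⟩
      ∣ X ∪ D ∣ + 0         ≡⟨ +-identityʳ _ ⟩
      ∣ X ∪ D ∣             ≤⟨ p⊆q⇒∣p∣≤∣q∣ X∪D⊆Y ⟩
      ∣ Y ∣                 ∎
      where open ≤-Reasoning
    ∁X⊆∁Y∪D : ∁ X ⊆ ∁ Y ∪ D
    ∁X⊆∁Y∪D {e} e∉X with e ∈? Y
    ... | yes e∈Y = x∈p∪q⁺ (inj₂ (x∈p∩q⁺ (e∈Y , e∉X)))
    ... | no  e∉Y = x∈p∪q⁺ (inj₁ (x∉p⇒x∈∁p e∉Y))
    r∁X≤ : r (∁ X) ≤ r (∁ Y) + ∣ D ∣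
    r∁X≤ = begin
      r (∁ X)       ≤⟨ rank-mono M ∁X⊆∁Y∪D ⟩
      r (∁ Y ∪ D)   ≤⟨ m+n≤o⇒m≤o _ (rank-sub M (∁ Y) D) ⟩
      r (∁ Y) + r D ≤⟨ +-monoʳ-≤ _ (rank-≤-∣∣ M D) ⟩
      r (∁ Y) + ∣ D ∣ ∎
      where open ≤-Reasoning

  dual : Matroid m
  dual .rank = dualRank r
  dual .rank-≤-∣∣ X = dual-≤-arith (dualRank r X) (∣ X ∣) (r ⊤) (r (∁ X)) (dualRank-spec X) (rank-mono M ⊆⊤)
  dual .rank-mono X⊆Y = ∸-monoˡ-≤ (r ⊤) (rank-∁-≤ X⊆Y)
  dual .rank-sub X Y =
    dual-sub-arith (dualRank r X) (dualRank r Y) (dualRank r (X ∪ Y)) (dualRank r (X ∩ Y)) (r ⊤)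
      (∣ X ∣) (∣ Y ∣) (∣ X ∪ Y ∣) (∣ X ∩ Y ∣)
      (r (∁ X)) (r (∁ Y)) (r (∁ (X ∪ Y))) (r (∁ (X ∩ Y)))
      (dualRank-spec X) (dualRank-spec Y) (dualRank-spec (X ∪ Y)) (dualRank-spec (X ∩ Y))
      (∣∪∣+∣∩∣ X Y)
      (subst₂ (λ V W → r V + r W ≤ r (∁ X) + r (∁ Y)) (sym (∁-∩ X Y)) (sym (∁-∪ X Y))
        (rank-sub M (∁ X) (∁ Y)))

module _ {m : ℕ} (M : Matroid m) where

  private r = rank M

  ∣p∣+∣∁p∣≡∣⊤∣ : ∀ (X : Subset m) → ∣ X ∣ + ∣ ∁ X ∣ ≡ ∣ ⊤ {m} ∣
  ∣p∣+∣∁p∣≡∣⊤∣ X = trans (cong (∣ X ∣ +_) (∣∁p∣≡n∸∣p∣ X)) (trans (m+[n∸m]≡n (∣p∣≤n X)) (sym (∣⊤∣≡n m)))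

  rank-∁⊤ : r (∁ ⊤) ≡ 0
  rank-∁⊤ = trans (cong r ∁⊤≡⊥) (rank-⊥ M)

  -- Expanding both duals leaves `r X`, because `∣ X ∣ + ∣ ∁ X ∣` is the size of the ground set and
  -- `∁ ⊤` has rank 0.
  dual-involutive : ∀ X → dualRank (dualRank r) X ≡ r X
  dual-involutive X =
    involutive-arith (dualRank (dualRank r) X) (dualRank r ⊤) (r ⊤) (dualRank r (∁ X)) (∣ X ∣) (∣ ∁ X ∣) (r X)
      (dualRank-spec (dual M) X) (dualRank-spec M ⊤) (dualRank-spec M (∁ X))
      (∣p∣+∣∁p∣≡∣⊤∣ X) rank-∁⊤ (cong r (∁-involutive X))

  conn-dual : ∀ X → conn (dualRank r) X ≡ conn r X
  conn-dual X =
    conn-dual-arith (conn r X) (conn (dualRank r) X) (dualRank r ⊤) (r ⊤) (dualRank r X) (dualRank r (∁ X))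
      (∣ X ∣) (∣ ∁ X ∣) (r (∁ X)) (r X)
      (conn-spec M X) (conn-spec (dual M) X) (dualRank-spec M X)
      (trans (dualRank-spec M (∁ X)) (cong (∣ ∁ X ∣ +_) (cong r (∁-involutive X)))) (dualRank-spec M ⊤)
      (∣p∣+∣∁p∣≡∣⊤∣ X) rank-∁⊤

  -- For disjoint sets the cardinalities in the dual ranks cancel, which leaves an equation between
  -- ranks of complements in `M` itself.
  lc*-spec : ∀ X Y → X ∩ Y ≡ ⊥ → lc* r X Y + r ⊤ + r (∁ (X ∪ Y)) ≡ r (∁ X) + r (∁ Y)
  lc*-spec X Y X∩Y≡⊥ =
    lc*-arith (lc* r X Y) (dualRank r (X ∪ Y)) (dualRank r X) (dualRank r Y) (r ⊤)
      (∣ X ∣) (∣ Y ∣) (∣ X ∪ Y ∣) (r (∁ X)) (r (∁ Y)) (r (∁ (X ∪ Y)))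
      (lc-spec (dualRank r) (rank-sub (dual M)) X Y) (dualRank-spec M X) (dualRank-spec M Y) (dualRank-spec M (X ∪ Y))
      (trans (sym (+-identityʳ _))
        (trans (cong (∣ X ∪ Y ∣ +_) (sym (trans (cong ∣_∣ X∩Y≡⊥) (∣⊥∣≡0 m)))) (∣∪∣+∣∩∣ X Y)))

-- Unions of blocks of a partition

⋃[_] : ∀ {m n} → Subset n → (Fin n → Subset m) → Subset m
⋃[ [] ]        P = ⊥
⋃[ true  ∷ S ] P = P zero ∪ ⋃[ S ] (P ∘ suc)
⋃[ false ∷ S ] P = ⋃[ S ] (P ∘ suc)

∈⋃⁺ : ∀ {m n} (S : Subset n) (P : Fin n → Subset m) {i e} → i ∈ S → e ∈ P i → e ∈ ⋃[ S ] P
∈⋃⁺ _           P here       e∈ = x∈p∪q⁺ (inj₁ e∈)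
∈⋃⁺ (true ∷ S)  P (there i∈) e∈ = x∈p∪q⁺ (inj₂ (∈⋃⁺ S (P ∘ suc) i∈ e∈))
∈⋃⁺ (false ∷ S) P (there i∈) e∈ = ∈⋃⁺ S (P ∘ suc) i∈ e∈

∈⋃⁻ : ∀ {m n} (S : Subset n) (P : Fin n → Subset m) {e} → e ∈ ⋃[ S ] P → ∃ λ i → i ∈ S × e ∈ P i
∈⋃⁻ []         P e∈ = contradiction e∈ ∉⊥
∈⋃⁻ (true ∷ S) P e∈ with x∈p∪q⁻ (P zero) _ e∈
... | inj₁ e∈P = zero , here , e∈P
... | inj₂ e∈⋃ = let i , i∈ , e∈P = ∈⋃⁻ S (P ∘ suc) e∈⋃ in suc i , there i∈ , e∈P
∈⋃⁻ (false ∷ S) P e∈ = let i , i∈ , e∈P = ∈⋃⁻ S (P ∘ suc) e∈ in suc i , there i∈ , e∈P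

⋃-∪ : ∀ {m n} (S T : Subset n) (P : Fin n → Subset m) → ⋃[ S ∪ T ] P ≡ ⋃[ S ] P ∪ ⋃[ T ] P
⋃-∪ S T P = ⊆-antisym to from
  where
  to : ⋃[ S ∪ T ] P ⊆ ⋃[ S ] P ∪ ⋃[ T ] P
  to e∈ with ∈⋃⁻ (S ∪ T) P e∈
  ... | i , i∈ , e∈P with x∈p∪q⁻ S T i∈
  ... | inj₁ i∈S = x∈p∪q⁺ (inj₁ (∈⋃⁺ S P i∈S e∈P))
  ... | inj₂ i∈T = x∈p∪q⁺ (inj₂ (∈⋃⁺ T P i∈T e∈P))
  from : ⋃[ S ] P ∪ ⋃[ T ] P ⊆ ⋃[ S ∪ T ] P
  from e∈ with x∈p∪q⁻ (⋃[ S ] P) _ e∈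
  ... | inj₁ e∈S = let i , i∈ , e∈P = ∈⋃⁻ S P e∈S in ∈⋃⁺ (S ∪ T) P (x∈p∪q⁺ (inj₁ i∈)) e∈P
  ... | inj₂ e∈T = let i , i∈ , e∈P = ∈⋃⁻ T P e∈T in ∈⋃⁺ (S ∪ T) P (x∈p∪q⁺ (inj₂ i∈)) e∈P

⋃-⁅⁆ : ∀ {m n} (i : Fin n) (P : Fin n → Subset m) → ⋃[ ⁅ i ⁆ ] P ≡ P i
⋃-⁅⁆ i P = ⊆-antisym to (∈⋃⁺ ⁅ i ⁆ P (x∈⁅x⁆ i))
  where
  to : ⋃[ ⁅ i ⁆ ] P ⊆ P i
  to e∈ with ∈⋃⁻ ⁅ i ⁆ P e∈
  ... | j , j∈ , e∈P rewrite x∈⁅y⁆⇒x≡y i j∈ = e∈P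

record IsPartition {m n} (P : Fin n → Subset m) : Set where
  field
    disjoint : ∀ {i j e} → e ∈ P i → e ∈ P j → i ≡ j
    covers   : ∀ e → ∃ λ i → e ∈ P i

module _ {m n} {P : Fin n → Subset m} (partition : IsPartition P) where
  open IsPartition partition

  ⋃-∩ : ∀ S T → ⋃[ S ∩ T ] P ≡ ⋃[ S ] P ∩ ⋃[ T ] P
  ⋃-∩ S T = ⊆-antisym to from
    where
    to : ⋃[ S ∩ T ] P ⊆ ⋃[ S ] P ∩ ⋃[ T ] P
    to e∈ = let i , i∈ , e∈P = ∈⋃⁻ (S ∩ T) P e∈ in
      x∈p∩q⁺ (∈⋃⁺ S P (p∩q⊆p S T i∈) e∈P , ∈⋃⁺ T P (p∩q⊆q S T i∈) e∈P)
    from : ⋃[ S ] P ∩ ⋃[ T ] P ⊆ ⋃[ S ∩ T ] P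
    from e∈ with ∈⋃⁻ S P (p∩q⊆p (⋃[ S ] P) (⋃[ T ] P) e∈) | ∈⋃⁻ T P (p∩q⊆q (⋃[ S ] P) (⋃[ T ] P) e∈)
    ... | i , i∈ , e∈Pi | j , j∈ , e∈Pj with disjoint e∈Pi e∈Pj
    ... | refl = ∈⋃⁺ (S ∩ T) P (x∈p∩q⁺ (i∈ , j∈)) e∈Pi

  ⋃-∁ : ∀ S → ⋃[ ∁ S ] P ≡ ∁ (⋃[ S ] P)
  ⋃-∁ S = ⊆-antisym to from
    where
    to : ⋃[ ∁ S ] P ⊆ ∁ (⋃[ S ] P)
    to e∈ with ∈⋃⁻ (∁ S) P e∈
    ... | i , i∈ , e∈Pi = x∉p⇒x∈∁p λ e∈S → let j , j∈ , e∈Pj = ∈⋃⁻ S P e∈S in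
      x∈∁p⇒x∉p i∈ (subst (_∈ S) (disjoint e∈Pj e∈Pi) j∈)
    from : ∁ (⋃[ S ] P) ⊆ ⋃[ ∁ S ] P
    from {e} e∈ with covers e
    ... | i , e∈Pi = ∈⋃⁺ (∁ S) P (x∉p⇒x∈∁p λ i∈S → x∈∁p⇒x∉p e∈ (∈⋃⁺ S P i∈S e∈Pi)) e∈Pi

  ⋃-⊤ : ⋃[ ⊤ ] P ≡ ⊤
  ⋃-⊤ = ⊆-antisym ⊆⊤ λ {e} _ → ∈⋃⁺ ⊤ P ∈⊤ (proj₂ (covers e))

-- Local connectivity to the ends of a flexipath

-- G S = ⊓(L, Q_S) = ⊓(R, Q_S) and K S = ⊓*(L, Q_S) = ⊓*(R, Q_S).
record Profile {m n} (r : RankFn m) (L R : Subset m) (Q : Fin n → Subset m) : Set where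
  field
    G K    : Subset n → ℕ
    G-mono : Monotone G
    K-mono : Monotone K
    G-sub  : Submodular G
    K-sub  : Submodular K
    cross  : ∀ S → G S + K (∁ S) ≤ 3
    single : ∀ i → G ⁅ i ⁆ + K ⁅ i ⁆ ≡ 2
    pair   : ∀ i j → i ≢ j → 3 ≤ G (⁅ i ⁆ ∪ ⁅ j ⁆) + K (⁅ i ⁆ ∪ ⁅ j ⁆)
    lc-LR  : lc r L R + K ⊤ ≡ 3
    lc*-LR : lc* r L R + G ⊤ ≡ 3
    lc-QL  : ∀ i → lc r (Q i) L ≡ G ⁅ i ⁆
    lc-QR  : ∀ i → lc r (Q i) R ≡ G ⁅ i ⁆
    lc*-QL : ∀ i → lc* r (Q i) L ≡ K ⁅ i ⁆
    lc*-QR : ∀ i → lc* r (Q i) R ≡ K ⁅ i ⁆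
    lc-QQ  : ∀ i j → i ≢ j → lc r (Q i) (Q j) + G (⁅ i ⁆ ∪ ⁅ j ⁆) ≡ G ⁅ i ⁆ + G ⁅ j ⁆
    lc*-QQ : ∀ i j → i ≢ j → lc* r (Q i) (Q j) + K (⁅ i ⁆ ∪ ⁅ j ⁆) ≡ K ⁅ i ⁆ + K ⁅ j ⁆
    r**≡r  : ∀ X → dualRank (dualRank r) X ≡ r X

  lc**≡lc : ∀ X Y → lc* (dualRank r) X Y ≡ lc r X Y
  lc**≡lc X Y = cong₂ _∸_ (cong₂ _+_ (r**≡r X) (r**≡r Y)) (r**≡r (X ∪ Y))

-- The roles of `G` and `K` are exchanged, and `cross` at `S` becomes `cross` at `∁ S`. The field
-- `r**≡r` turns quantities of the double dual back into the original ones.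
dualProfile : ∀ {m n} {r : RankFn m} {L R} {Q : Fin n → Subset m} → Profile r L R Q → Profile (dualRank r) L R Q
dualProfile {r = r} p = record
  { G = K ; K = G ; G-mono = K-mono ; K-mono = G-mono ; G-sub = K-sub ; K-sub = G-sub
  ; cross = λ S → ≤-trans (≤-reflexive (trans (cong (λ T → K T + G (∁ S)) (sym (∁-involutive S))) (+-comm (K (∁ (∁ S))) _)))
      (cross (∁ S))
  ; single = λ i → trans (+-comm (K ⁅ i ⁆) _) (single i)
  ; pair = λ i j i≢j → ≤-trans (pair i j i≢j) (≤-reflexive (+-comm (G (⁅ i ⁆ ∪ ⁅ j ⁆)) _))
  ; lc-LR = lc*-LR ; lc*-LR = trans (cong (_+ K ⊤) (lc**≡lc _ _)) lc-LR
  ; lc-QL = lc*-QL ; lc-QR = lc*-QR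
  ; lc*-QL = λ i → trans (lc**≡lc _ _) (lc-QL i)
  ; lc*-QR = λ i → trans (lc**≡lc _ _) (lc-QR i)
  ; lc-QQ = lc*-QQ
  ; lc*-QQ = λ i j i≢j → trans (cong (_+ G (⁅ i ⁆ ∪ ⁅ j ⁆)) (lc**≡lc _ _)) (lc-QQ i j i≢j)
  ; r**≡r = λ X → cong₂ _∸_ (cong (∣ X ∣ +_) (r**≡r (∁ X))) (r**≡r ⊤)
  }
  where
  open Profile p

blocks : ∀ {m n} → Subset m → Subset m → (Fin n → Subset m) → Fin (2 + n) → Subset m
blocks L R Q zero          = L
blocks L R Q (suc zero)    = R
blocks L R Q (suc (suc i)) = Q i

-- Reorderings are replaced by sets of steps: every set of steps is an initial segment of some
-- ordering.
record Flexipath {m n} (r : RankFn m) (L R : Subset m) (Q : Fin n → Subset m) : Set where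
  field
    partition : IsPartition (blocks L R Q)
    flexible  : ∀ S → conn r (L ∪ ⋃[ S ] Q) ≡ 3
    conn-step : ∀ i → conn r (Q i) ≡ 2
    conn-pair : ∀ i j → i ≢ j → 2 < conn r (Q i ∪ Q j)

-- Everything is computed in the rank function pulled back along S ↦ ⋃[ S ] (blocks L R Q):
-- there the first two bits of an index set record L and R, so that the Boolean identities
-- between unions of blocks hold by computation.
module _ {m n} (M : Matroid m) {L R : Subset m} {Q : Fin n → Subset m} (F : Flexipath (rank M) L R Q) where

  open Flexipath F
  private
    r = rank M
    P = blocks L R Q

    f : Subset (2 + n) → ℕ
    f S = r (⋃[ S ] P)

    -- The ranks of Q_S together with `L`, together with `R`, alone, and together with both ends.
    A B g h : Subset n → ℕ
    A S = f (true  ∷ false ∷ S)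
    B S = f (false ∷ true  ∷ S)
    g S = f (false ∷ false ∷ S)
    h S = f (true  ∷ true  ∷ S)

    L′ R′ : Subset (2 + n)
    L′ = true ∷ ⊥
    R′ = false ∷ true ∷ ⊥

    f-mono : Monotone f
    f-mono {S} {T} S⊆T = rank-mono M λ e∈ →
      let i , i∈ , e∈P = ∈⋃⁻ S P e∈ in ∈⋃⁺ T P (S⊆T i∈) e∈P

    f-sub : Submodular f
    f-sub S T = subst₂ (λ X Y → r X + r Y ≤ f S + f T) (sym (⋃-∪ S T P)) (sym (⋃-∩ partition S T))
      (rank-sub M (⋃[ S ] P) (⋃[ T ] P))

    lc-⋃ : ∀ (r : RankFn m) S T → lc r (⋃[ S ] P) (⋃[ T ] P) ≡ lc (λ S → r (⋃[ S ] P)) S T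
    lc-⋃ r S T = cong (λ X → r (⋃[ S ] P) + r (⋃[ T ] P) ∸ r X) (sym (⋃-∪ S T P))

    f-conn : ∀ S → conn r (⋃[ S ] P) + f ⊤ ≡ f S + f (∁ S)
    f-conn S = trans (cong (conn r (⋃[ S ] P) +_) (cong r (⋃-⊤ partition)))
      (trans (conn-spec M _) (cong (f S +_) (cong r (sym (⋃-∁ partition S)))))

    -- The index set `true ∷ false ∷ S` computes to `L ∪ ⋃[ S ] Q`, and its complement to `R` with
    -- the remaining steps, so this is `flexible` with the connectivity expanded.
    A+B∁ : ∀ S → A S + B (∁ S) ≡ 3 + f ⊤
    A+B∁ S = trans (sym (f-conn (true ∷ false ∷ S))) (cong (_+ f ⊤) (flexible S))

    A⊥+B⊤ : A ⊥ + B ⊤ ≡ 3 + f ⊤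
    A⊥+B⊤ = trans (cong (λ S → A ⊥ + B S) (sym ∁⊥≡⊤)) (A+B∁ ⊥)

    -- S ↦ A S is submodular, and so is S ↦ B (∁ S) = 3 + f ⊤ − A S.
    A-modular : ∀ S T → A (S ∪ T) + A (S ∩ T) ≡ A S + A T
    A-modular S T = ≤-antisym (f-sub (true ∷ false ∷ S) (true ∷ false ∷ T))
      (modular-arith (3 + f ⊤) (A S) (A T) (A (S ∪ T)) (A (S ∩ T))
        (B (∁ S)) (B (∁ T)) (B (∁ S ∪ ∁ T)) (B (∁ S ∩ ∁ T))
        (A+B∁ S) (A+B∁ T)
        (subst (λ U → A (S ∪ T) + B U ≡ 3 + f ⊤) (∁-∪ S T) (A+B∁ (S ∪ T)))
        (subst (λ U → A (S ∩ T) + B U ≡ 3 + f ⊤) (∁-∩ S T) (A+B∁ (S ∩ T)))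
        (f-sub (false ∷ true ∷ ∁ S) (false ∷ true ∷ ∁ T)))

    -- Adding Q_S raises the ranks of `L` and `R` by the same amount: modularity on `S` and `∁ S`
    -- gives A(S) - A(∅) = A([n]) - A([n]-S), and by `A+B∁` the right side is B(S) - B(∅).
    A-B : ∀ S → A S + B ⊥ ≡ B S + A ⊥
    A-B S = A-B-arith (3 + f ⊤) (A S) (A (∁ S)) (A ⊤) (A ⊥) (B S) (B ⊥)
      (trans (sym (A-modular S (∁ S))) (cong₂ (λ X Y → A X + A Y) (p∪∁p≡⊤ S) (∩-inverseʳ S)))
      (subst (λ X → A (∁ S) + B X ≡ 3 + f ⊤) (∁-involutive S) (A+B∁ (∁ S)))
      (subst (λ X → A ⊤ + B X ≡ 3 + f ⊤) ∁⊤≡⊥ (A+B∁ ⊤))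

    G : Subset n → ℕ
    G S = lc f L′ (false ∷ false ∷ S)

    G-spec : ∀ S → G S + A S ≡ A ⊥ + g S
    G-spec S = trans (cong (λ X → G S + A X) (sym (∪-identityˡ S))) (lc-spec f f-sub L′ (false ∷ false ∷ S))

  module LocalConnectivity where

    ⊓L : Subset n → ℕ
    ⊓L = G

    ⊓L-mono : Monotone G
    ⊓L-mono {S} {T} S⊆T = lc-monoʳ f f-sub f-mono L′ {false ∷ false ∷ S} {false ∷ false ∷ T} (s⊆s (s⊆s S⊆T))

    -- By `G-spec`, `G` is a constant plus the submodular `g` minus the modular `A`.
    ⊓L-sub : Submodular G
    ⊓L-sub S T =
      G-sub-arith (G S) (G T) (G (S ∪ T)) (G (S ∩ T)) (A S) (A T) (A (S ∪ T)) (A (S ∩ T))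
        (g S) (g T) (g (S ∪ T)) (g (S ∩ T)) (A ⊥)
        (G-spec S) (G-spec T) (G-spec (S ∪ T)) (G-spec (S ∩ T)) (A-modular S T)
        (f-sub (false ∷ false ∷ S) (false ∷ false ∷ T))

    ⊓L-step : ∀ i → lc r (Q i) L ≡ G ⁅ i ⁆
    ⊓L-step i = trans (lc-comm r (Q i) L)
      (trans (sym (cong₂ (lc r) (⋃-⁅⁆ zero P) (⋃-⁅⁆ (suc (suc i)) P))) (lc-⋃ r L′ (false ∷ false ∷ ⁅ i ⁆)))

    -- The connectivity to `R` uses `B` where `G` uses `A`; `A-B` says that the two rank increases
    -- agree.
    ⊓R-step : ∀ i → lc r (Q i) R ≡ G ⁅ i ⁆
    ⊓R-step i = trans (lc-comm r (Q i) R)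
      (trans (sym (cong₂ (lc r) (⋃-⁅⁆ (suc zero) P) (⋃-⁅⁆ (suc (suc i)) P)))
      (trans (lc-⋃ r R′ (false ∷ false ∷ ⁅ i ⁆))
      (G-R-arith (lc f R′ (false ∷ false ∷ ⁅ i ⁆)) (G ⁅ i ⁆) (A ⁅ i ⁆) (B ⁅ i ⁆) (A ⊥) (B ⊥) (g ⁅ i ⁆)
        (trans (cong (λ X → lc f R′ (false ∷ false ∷ ⁅ i ⁆) + B X) (sym (∪-identityˡ ⁅ i ⁆))) (lc-spec f f-sub R′ (false ∷ false ∷ ⁅ i ⁆)))
        (G-spec ⁅ i ⁆) (A-B ⁅ i ⁆))))

    -- Since `A` is modular, the failure of `G` to be additive on two disjoint steps is that of `g`,
    -- which is their local connectivity.
    ⊓-steps : ∀ i j → i ≢ j → lc r (Q i) (Q j) + G (⁅ i ⁆ ∪ ⁅ j ⁆) ≡ G ⁅ i ⁆ + G ⁅ j ⁆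
    ⊓-steps i j i≢j = trans
      (cong (_+ G (S ∪ T)) (trans (sym (cong₂ (lc r) (⋃-⁅⁆ i Q) (⋃-⁅⁆ j Q)))
        (lc-⋃ r (false ∷ false ∷ S) (false ∷ false ∷ T))))
      (G-pair-arith (lc f (false ∷ false ∷ S) (false ∷ false ∷ T)) (G S) (G T) (G (S ∪ T))
        (A S) (A T) (A (S ∪ T)) (A ⊥) (g S) (g T) (g (S ∪ T))
        (lc-spec f f-sub (false ∷ false ∷ S) (false ∷ false ∷ T)) (G-spec (S ∪ T)) (G-spec S) (G-spec T)
        (trans (cong (λ X → A (S ∪ T) + A X) (sym (⁅⁆-∩ i≢j))) (A-modular S T)))
      where
      S = ⁅ i ⁆
      T = ⁅ j ⁆

  dualFlexipath : Flexipath (dualRank r) L R Q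
  dualFlexipath = record
    { partition = partition
    ; flexible  = λ S → trans (conn-dual M _) (flexible S)
    ; conn-step = λ i → trans (conn-dual M _) (conn-step i)
    ; conn-pair = λ i j i≢j → subst (2 <_) (sym (conn-dual M _)) (conn-pair i j i≢j)
    }

  -- K will be the G of the dual matroid.
  module WithDual (K : Subset n → ℕ)
    (K≡lc* : ∀ S → K S ≡ lc (λ S → dualRank r (⋃[ S ] P)) L′ (false ∷ false ∷ S)) where

    f-lc*-spec : ∀ S T → S ∩ T ≡ ⊥ → lc* r (⋃[ S ] P) (⋃[ T ] P) + f ⊤ + f (∁ (S ∪ T)) ≡ f (∁ S) + f (∁ T)
    f-lc*-spec S T S∩T≡⊥ = trans
      (cong₂ (λ X Y → lc* r (⋃[ S ] P) (⋃[ T ] P) + r X + r Y) (⋃-⊤ partition)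
        (trans (⋃-∁ partition (S ∪ T)) (cong ∁ (⋃-∪ S T P))))
      (trans (lc*-spec M (⋃[ S ] P) (⋃[ T ] P)
        (trans (sym (⋃-∩ partition S T)) (trans (cong (λ X → ⋃[ X ] P) S∩T≡⊥) ⋃[⊥]≡⊥)))
      (sym (cong₂ (λ X Y → r X + r Y) (⋃-∁ partition S) (⋃-∁ partition T))))
      where
      ⋃[⊥]≡⊥ : ⋃[ ⊥ ] P ≡ ⊥
      ⋃[⊥]≡⊥ = Empty-unique λ (e , e∈) → ∉⊥ (proj₁ (proj₂ (∈⋃⁻ ⊥ P e∈)))

    -- The instance of `lc*-spec` for `L` and Q_S: the complement of `L` is `R` with all steps, that
    -- of Q_S is both ends with the steps outside `S`, and that of their union is `R` with the steps
    -- outside `S`.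
    K-spec : ∀ S → K S + f ⊤ + B (∁ S) ≡ B ⊤ + h (∁ S)
    K-spec S = trans
      (cong₂ (λ k X → k + f ⊤ + B (∁ X)) (trans (K≡lc* S) (sym (lc-⋃ (dualRank r) L′ (false ∷ false ∷ S)))) (sym (∪-identityˡ S)))
      (trans (f-lc*-spec L′ (false ∷ false ∷ S) (cong (λ X → false ∷ false ∷ X) (∩-zeroˡ S)))
        (cong (λ X → B X + h (∁ S)) ∁⊥≡⊤))

    -- After substituting the two specifications this is submodularity of the rank on L ∪ Q_S and R
    -- ∪ Q_S, whose union has rank `h S` and whose intersection has rank `g S`.
    ⊓L-cross : ∀ S → G S + K (∁ S) ≤ 3
    ⊓L-cross S = cross-arith (G S) (K (∁ S)) (f ⊤) (A S) (A ⊥) (B S) (B ⊤) (g S) (h S)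
      (G-spec S)
      (subst (λ X → K (∁ S) + f ⊤ + B X ≡ B ⊤ + h X) (∁-involutive S) (K-spec (∁ S)))
      A⊥+B⊤
      (subst₂ (λ X Y → h X + g Y ≤ A S + B S) (∪-idem S) (∩-idem S)
        (f-sub (true ∷ false ∷ S) (false ∷ true ∷ S)))

    -- `K-spec` at `⊤` brings in `h ⊥`, the rank of `L ∪ R`; the constant 3 is the connectivity of
    -- `L`, through `A⊥+B⊤`.
    ⊓LR : lc r L R + K ⊤ ≡ 3
    ⊓LR = trans
      (cong (_+ K ⊤) (trans (sym (cong₂ (lc r) (⋃-⁅⁆ zero P) (⋃-⁅⁆ (suc zero) P))) (lc-⋃ r L′ R′)))
      (LR-arith (lc f L′ R′) (K ⊤) (f ⊤) (A ⊥) (B ⊤) (B ⊥) (h ⊥)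
        (trans (cong (λ X → lc f L′ R′ + h X) (sym (∪-identityˡ ⊥))) (lc-spec f f-sub L′ R′))
        (subst (λ X → K ⊤ + f ⊤ + B X ≡ B ⊤ + h X) ∁⊤≡⊥ (K-spec ⊤))
        A⊥+B⊤)

    ⊓*LR : lc* r L R + G ⊤ ≡ 3
    ⊓*LR = trans (cong (_+ G ⊤) (sym (cong₂ (lc* r) (⋃-⁅⁆ zero P) (⋃-⁅⁆ (suc zero) P))))
      (LR*-arith l (G ⊤) (f ⊤) (A ⊤) (A ⊥) (B ⊤) (g ⊤)
        (trans (cong (λ X → l + f ⊤ + g X) (sym (trans (cong ∁ (∪-identityˡ ⊥)) ∁⊥≡⊤)))
          (trans (f-lc*-spec L′ R′ (cong (λ X → false ∷ false ∷ X) (∩-zeroˡ ⊥)))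
            (cong (λ X → B X + A X) ∁⊥≡⊤)))
        (G-spec ⊤) A⊥+B⊤)
      where
      l = lc* r (⋃[ L′ ] P) (⋃[ R′ ] P)

    -- In the sum of `G-spec` and `K-spec` the terms in `A` and `B` cancel by flexibility, leaving
    -- g(S) + h([n]-S) - r(M).
    ⊓+⊓* : ∀ S → G S + K S ≡ conn r (⋃[ S ] Q)
    ⊓+⊓* S = conn-arith (G S) (K S) (conn r (⋃[ S ] Q)) (f ⊤) (A S) (A ⊥) (B (∁ S)) (B ⊤) (g S) (h (∁ S))
      (G-spec S) (K-spec S) A⊥+B⊤ (A+B∁ S) (f-conn (false ∷ false ∷ S))

profile : ∀ {m n} (M : Matroid m) {L R : Subset m} {Q : Fin n → Subset m} →
  Flexipath (rank M) L R Q → Profile (rank M) L R Q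
profile M {Q = Q} F = record
  { G = ⊓L M F
  ; K = ⊓L (dual M) F*
  ; G-mono = ⊓L-mono M F
  ; K-mono = ⊓L-mono (dual M) F*
  ; G-sub = ⊓L-sub M F
  ; K-sub = ⊓L-sub (dual M) F*
  ; cross = ⊓L-cross
  ; single = λ i → trans (⊓+⊓* ⁅ i ⁆) (trans (cong (conn r) (⋃-⁅⁆ i Q)) (conn-step i))
  ; pair = λ i j i≢j → ≤-trans (conn-pair i j i≢j) (≤-reflexive (trans
      (cong (conn r) (sym (trans (⋃-∪ ⁅ i ⁆ ⁅ j ⁆ Q) (cong₂ _∪_ (⋃-⁅⁆ i Q) (⋃-⁅⁆ j Q)))))
      (sym (⊓+⊓* (⁅ i ⁆ ∪ ⁅ j ⁆)))))
  ; lc-LR = ⊓LR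
  ; lc*-LR = ⊓*LR
  ; lc-QL = ⊓L-step M F
  ; lc-QR = ⊓R-step M F
  ; lc*-QL = ⊓L-step (dual M) F*
  ; lc*-QR = ⊓R-step (dual M) F*
  ; lc-QQ = ⊓-steps M F
  ; lc*-QQ = ⊓-steps (dual M) F*
  ; r**≡r = dual-involutive M
  }
  where
  open LocalConnectivity
  open Flexipath F
  r = rank M
  F* = dualFlexipath M F
  -- `refl` suffices because the `G` of `dual M` is by definition local connectivity for
  -- `dualRank r`, pulled back to index sets.
  open WithDual M F (⊓L (dual M) F*) (λ _ → refl)

-- Classification of the pairs (G, K)

∪-lub : ∀ {n} {S T U : Subset n} → S ⊆ U → T ⊆ U → S ∪ T ⊆ U
∪-lub {S = S} {T} S⊆U T⊆U e∈ with x∈p∪q⁻ S T e∈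
... | inj₁ e∈S = S⊆U e∈S
... | inj₂ e∈T = T⊆U e∈T

⁅⁆⊆ : ∀ {n} {S : Subset n} {i} → i ∈ S → ⁅ i ⁆ ⊆ S
⁅⁆⊆ {S = S} {i} i∈S e∈ = subst (_∈ S) (sym (x∈⁅y⁆⇒x≡y i e∈)) i∈S

Subset-induction : ∀ {n} (P : Subset n → Set) → P ⊥ → (∀ i T → P T → P (⁅ i ⁆ ∪ T)) → ∀ T → P T
Subset-induction {zero}  P P⊥ step [] = P⊥
Subset-induction {suc n} P P⊥ step (s ∷ T) = extend s
  where
  P-outside : P (outside ∷ T)
  P-outside = Subset-induction (λ T → P (outside ∷ T)) P⊥ (λ i T → step (suc i) (outside ∷ T)) T
  extend : ∀ s → P (s ∷ T)
  extend false = P-outside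
  extend true  = subst (λ T → P (inside ∷ T)) (∪-identityˡ T) (step zero (outside ∷ T) P-outside)

m+n≡o⇒m≡o∸n : ∀ {m n o} → m + n ≡ o → m ≡ o ∸ n
m+n≡o⇒m≡o∸n {m} {n} eq = trans (sym (m+n∸n≡m m n)) (cong (_∸ n) eq)

m+n≤o⇒n≤o∸m : ∀ {m n o} → m + n ≤ o → n ≤ o ∸ m
m+n≤o⇒n≤o∸m {m} {n} le = m+n≤o⇒m≤o∸n n (≤-trans (≤-reflexive (+-comm n m)) le)

2or3 : ∀ {x} → 2 ≤ x → x ≤ 3 → x ≡ 2 ⊎ x ≡ 3
2or3 {2} _ _ = inj₁ refl
2or3 {3} _ _ = inj₂ refl
2or3 {suc (suc (suc (suc _)))} _ (s≤s (s≤s (s≤s ())))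
2or3 {1} (s≤s ()) _

module Facts {m n} {r : RankFn m} {L R : Subset m} {Q : Fin n → Subset m} (p : Profile r L R Q) where
  open Profile p

  G-cover : ∀ {S} T U → S ⊆ T ∪ U → G S ≤ G T + G U
  G-cover T U S⊆ = ≤-trans (G-mono S⊆) (m+n≤o⇒m≤o _ (G-sub T U))

  K-cover : ∀ {S} T U → S ⊆ T ∪ U → K S ≤ K T + K U
  K-cover T U S⊆ = ≤-trans (K-mono S⊆) (m+n≤o⇒m≤o _ (K-sub T U))

  G≤3 : ∀ S → G S ≤ 3
  G≤3 S = m+n≤o⇒m≤o _ (cross S)

  -- The differences reduce to numerals once `a` and `b` are known, so each use matches a named
  -- outcome directly.
  LR-is : ∀ {a b} → K ⊤ ≡ a → G ⊤ ≡ b → LRis r L R (3 ∸ a) (3 ∸ b)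
  LR-is refl refl = m+n≡o⇒m≡o∸n lc-LR , m+n≡o⇒m≡o∸n lc*-LR

  pair-is : ∀ {a b c d i j} → G ⁅ i ⁆ ≡ c → G ⁅ j ⁆ ≡ c → K ⁅ i ⁆ ≡ d → K ⁅ j ⁆ ≡ d → i ≢ j →
    G (⁅ i ⁆ ∪ ⁅ j ⁆) ≡ a → K (⁅ i ⁆ ∪ ⁅ j ⁆) ≡ b → PairIs r Q i j (c + c ∸ a) (d + d ∸ b)
  pair-is {i = i} {j} Gi Gj Ki Kj i≢j refl refl =
    m+n≡o⇒m≡o∸n (trans (lc-QQ i j i≢j) (cong₂ _+_ Gi Gj)) ,
    m+n≡o⇒m≡o∸n (trans (lc*-QQ i j i≢j) (cong₂ _+_ Ki Kj))

  -- A step with ⊓(L,Qᵢ) = 2 leaves room for ⊓*(L,-) ≤ 1 on the other steps, and contributes 0 itself.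
  module _ {i} (Gi≡2 : G ⁅ i ⁆ ≡ 2) where

    Ki≡0 : K ⁅ i ⁆ ≡ 0
    Ki≡0 = +-cancelˡ-≡ 2 _ _ (trans (cong (_+ K ⁅ i ⁆) (sym Gi≡2)) (single i))

    K⊤≤1 : K ⊤ ≤ 1
    K⊤≤1 = begin
      K ⊤                   ≤⟨ K-cover ⁅ i ⁆ (∁ ⁅ i ⁆) (⊆-reflexive (sym (p∪∁p≡⊤ ⁅ i ⁆))) ⟩
      K ⁅ i ⁆ + K (∁ ⁅ i ⁆) ≡⟨ cong (_+ K (∁ ⁅ i ⁆)) Ki≡0 ⟩
      K (∁ ⁅ i ⁆)           ≤⟨ m+n≤o⇒n≤o∸m (subst (λ x → x + K (∁ ⁅ i ⁆) ≤ 3) Gi≡2 (cross ⁅ i ⁆)) ⟩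
      1                     ∎
      where open ≤-Reasoning

    -- If `K ⁅ j ⁆` were 0, then `K` would vanish on the pair `JI`. Then `pair` gives `G JI` at
    -- least 3, so `cross` makes `K` vanish off `JI` as well, contradicting `K ⊤ ≡ 1`.
    other-steps : K ⊤ ≡ 1 → ∀ j → j ≢ i → G ⁅ j ⁆ ≡ 1 × K ⁅ j ⁆ ≡ 1
    other-steps K⊤≡1 j j≢i = split (K ⁅ j ⁆) refl (≤-trans (K-mono ⊆⊤) (≤-reflexive K⊤≡1))
      where
      JI = ⁅ j ⁆ ∪ ⁅ i ⁆
      split : ∀ x → K ⁅ j ⁆ ≡ x → x ≤ 1 → G ⁅ j ⁆ ≡ 1 × K ⁅ j ⁆ ≡ 1
      split 1 Kj≡1 _ = +-cancelʳ-≡ 1 _ _ (trans (cong (G ⁅ j ⁆ +_) (sym Kj≡1)) (single j)) , Kj≡1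
      split (suc (suc _)) _ (s≤s ())
      split 0 Kj≡0 _ = contradiction (trans (sym K⊤≡1) (n≤0⇒n≡0 K⊤≤0)) λ ()
        where
        KJI≤0 : K JI ≤ 0
        KJI≤0 = ≤-trans (K-cover ⁅ j ⁆ ⁅ i ⁆ ⊆-refl) (≤-reflexive (cong₂ _+_ Kj≡0 Ki≡0))
        3≤GJI : 3 ≤ G JI
        3≤GJI = ≤-trans (pair j i j≢i) (≤-trans (+-monoʳ-≤ (G JI) KJI≤0) (≤-reflexive (+-identityʳ _)))
        K∁JI≤0 : K (∁ JI) ≤ 0
        K∁JI≤0 = m+n≤o⇒n≤o∸m (≤-trans (+-monoˡ-≤ (K (∁ JI)) 3≤GJI) (cross JI))
        K⊤≤0 : K ⊤ ≤ 0
        K⊤≤0 = ≤-trans (K-cover JI (∁ JI) (⊆-reflexive (sym (p∪∁p≡⊤ JI)))) (+-mono-≤ KJI≤0 K∁JI≤0)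

module _ {m n} {r : RankFn m} {L R : Subset m} {Q : Fin (2 + n) → Subset m} (p : Profile r L R Q) where
  open Profile p
  open Facts p

  -- The bound `K⊤≤1` leaves 0 and 1, and the value 1 would mean that the ends have local
  -- connectivity 2. Once `K` is 0 everywhere, `single` and `pair` determine `G`.
  squashed : ∀ {i} → G ⁅ i ⁆ ≡ 2 → lc r L R ≢ 2 → Squashed r L Q R
  -- `punchIn i zero` is a step other than `i`; this pair already has `G` equal to 3, the largest
  -- possible value, so `G ⊤` is 3.
  squashed {i} Gi≡2 lc≢2 = LR-is K⊤≡0 (≤-antisym (G≤3 ⊤) (≤-trans (≤-reflexive (sym (Gij≡3 (punchInᵢ≢i i zero)))) (G-mono ⊆⊤))) ,
    (λ a b a≢b → pair-is (G≡2 a) (G≡2 b) (K≡0 _) (K≡0 _) a≢b (Gij≡3 a≢b) (K≡0 _)) ,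
    (λ a → trans (lc-QL a) (G≡2 a) , trans (lc-QR a) (G≡2 a) ,
           trans (lc*-QL a) (K≡0 ⁅ a ⁆) , trans (lc*-QR a) (K≡0 ⁅ a ⁆))
    where
    K⊤≡0 : K ⊤ ≡ 0
    K⊤≡0 = n<1⇒n≡0 (≤∧≢⇒< (K⊤≤1 Gi≡2) λ K⊤≡1 → lc≢2 (proj₁ (LR-is K⊤≡1 refl)))
    K≡0 : ∀ S → K S ≡ 0
    K≡0 S = n≤0⇒n≡0 (≤-trans (K-mono ⊆⊤) (≤-reflexive K⊤≡0))
    G≡2 : ∀ a → G ⁅ a ⁆ ≡ 2
    G≡2 a = trans (m+n≡o⇒m≡o∸n (single a)) (cong (2 ∸_) (K≡0 ⁅ a ⁆))
    Gij≡3 : ∀ {a b} → a ≢ b → G (⁅ a ⁆ ∪ ⁅ b ⁆) ≡ 3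
    Gij≡3 {a} {b} a≢b = ≤-antisym (G≤3 _) (subst (3 ≤_)
      (trans (cong (G (⁅ a ⁆ ∪ ⁅ b ⁆) +_) (K≡0 _)) (+-identityʳ _)) (pair a b a≢b))

-- Profiles in which G and K are 1 on every step

record UnitProfile {m n} (r : RankFn m) (L R : Subset m) (Q : Fin n → Subset m) : Set where
  field
    base : Profile r L R Q
  open Profile base public
  field
    G≡1 : ∀ i → G ⁅ i ⁆ ≡ 1
    K≡1 : ∀ i → K ⁅ i ⁆ ≡ 1

dualUnitProfile : ∀ {m n} {r : RankFn m} {L R} {Q : Fin n → Subset m} →
  UnitProfile r L R Q → UnitProfile (dualRank r) L R Q
dualUnitProfile u = record { base = dualProfile base ; G≡1 = K≡1 ; K≡1 = G≡1 }
  where open UnitProfile u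

module Unit {m n} {r : RankFn m} {L R : Subset m} {Q : Fin n → Subset m} (u : UnitProfile r L R Q) where
  open UnitProfile u
  open Facts base public

  ⟨_,_⟩ : Fin n → Fin n → Subset n
  ⟨ i , j ⟩ = ⁅ i ⁆ ∪ ⁅ j ⁆

  condB : CondB r L Q R
  condB i = trans (lc-QL i) (G≡1 i) , trans (lc-QR i) (G≡1 i) , trans (lc*-QL i) (K≡1 i) , trans (lc*-QR i) (K≡1 i)

  pairIs : ∀ {a b i j} → i ≢ j → G ⟨ i , j ⟩ ≡ a → K ⟨ i , j ⟩ ≡ b → PairIs r Q i j (2 ∸ a) (2 ∸ b)
  pairIs {i = i} {j} = pair-is (G≡1 i) (G≡1 j) (K≡1 i) (K≡1 j)

  1≤G : ∀ {S i} → i ∈ S → 1 ≤ G S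
  1≤G {i = i} i∈S = ≤-trans (≤-reflexive (sym (G≡1 i))) (G-mono (⁅⁆⊆ i∈S))

  Gij≤2 : ∀ i j → G ⟨ i , j ⟩ ≤ 2
  Gij≤2 i j = ≤-trans (G-cover ⁅ i ⁆ ⁅ j ⁆ ⊆-refl) (≤-reflexive (cong₂ _+_ (G≡1 i) (G≡1 j)))

  Kij≤2 : ∀ i j → K ⟨ i , j ⟩ ≤ 2
  Kij≤2 i j = ≤-trans (K-cover ⁅ i ⁆ ⁅ j ⁆ ⊆-refl) (≤-reflexive (cong₂ _+_ (K≡1 i) (K≡1 j)))

  -- The shared step makes `G (S ∩ T)` at least 1, so submodularity bounds `G (S ∪ T)` by 1.
  G-merge : ∀ {S T U i} → i ∈ S → i ∈ T → U ⊆ S ∪ T → G S ≤ 1 → G T ≤ 1 → G U ≤ 1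
  G-merge {S} {T} i∈S i∈T U⊆ GS≤1 GT≤1 = ≤-trans (G-mono U⊆) (+-cancelʳ-≤ 1 _ _
    (≤-trans (+-monoʳ-≤ (G (S ∪ T)) (1≤G (x∈p∩q⁺ (i∈S , i∈T))))
      (≤-trans (G-sub S T) (+-mono-≤ GS≤1 GT≤1))))

  Parallel : Fin n → Fin n → Set
  Parallel i j = G ⟨ i , j ⟩ ≡ 1

  Parallel-refl : ∀ {i} → Parallel i i
  Parallel-refl {i} = trans (cong G (∪-idem ⁅ i ⁆)) (G≡1 i)

  Parallel-sym : ∀ {i j} → Parallel i j → Parallel j i
  Parallel-sym {i} {j} = trans (cong G (∪-comm ⁅ j ⁆ ⁅ i ⁆))

  -- Transitivity through the common step `i`, as in a rank-one flat: `G-merge` for the two pairs.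
  Parallel-join : ∀ {i j k} → Parallel i j → Parallel i k → Parallel j k
  Parallel-join {i} {j} {k} ij ik = ≤-antisym
    (G-merge (p⊆p∪q _ (x∈⁅x⁆ i)) (p⊆p∪q _ (x∈⁅x⁆ i)) (∪-lub (p⊆p∪q _ ∘ q⊆p∪q ⁅ i ⁆ _) (q⊆p∪q ⟨ i , j ⟩ _ ∘ q⊆p∪q ⁅ i ⁆ _))
      (≤-reflexive ij) (≤-reflexive ik))
    (1≤G (p⊆p∪q _ (x∈⁅x⁆ j)))

  -- Steps are added to `⁅ c ⁆` one at a time; each is merged in through its pair with `c`, so `G`
  -- stays at most 1.
  G⊤≤1 : ∀ c → (∀ b → Parallel c b) → G ⊤ ≤ 1
  G⊤≤1 c par = subst (λ S → G S ≤ 1) (∪-zeroʳ ⁅ c ⁆) (Subset-induction (λ T → G (⁅ c ⁆ ∪ T) ≤ 1)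
    (≤-reflexive (trans (cong G (∪-identityʳ ⁅ c ⁆)) (G≡1 c)))
    (λ i T → G-merge (p⊆p∪q _ (x∈⁅x⁆ c)) (p⊆p∪q _ (x∈⁅x⁆ c))
      (∪-lub (p⊆p∪q _ ∘ p⊆p∪q ⁅ i ⁆) (∪-lub (p⊆p∪q _ ∘ q⊆p∪q ⁅ c ⁆ _) (q⊆p∪q ⟨ c , i ⟩ _ ∘ q⊆p∪q ⁅ c ⁆ _)))
      (≤-reflexive (par i)))
    ⊤)

  data PairType (i j : Fin n) : Set where
    parallel   : G ⟨ i , j ⟩ ≡ 1 → K ⟨ i , j ⟩ ≡ 2 → PairType i j
    coparallel : G ⟨ i , j ⟩ ≡ 2 → K ⟨ i , j ⟩ ≡ 1 → PairType i j
    skew       : G ⟨ i , j ⟩ ≡ 2 → K ⟨ i , j ⟩ ≡ 2 → PairType i j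

  -- Both values are at most 2 by subadditivity and their sum is at least 3 by `pair`.
  pairType : ∀ i j → i ≢ j → PairType i j
  pairType i j i≢j = split _ _ refl refl (Gij≤2 i j) (Kij≤2 i j) (pair i j i≢j)
    where
    split : ∀ x y → G ⟨ i , j ⟩ ≡ x → K ⟨ i , j ⟩ ≡ y → x ≤ 2 → y ≤ 2 → 3 ≤ x + y → PairType i j
    split 1 2 Gx Ky _ _ _ = parallel Gx Ky
    split 2 1 Gx Ky _ _ _ = coparallel Gx Ky
    split 2 2 Gx Ky _ _ _ = skew Gx Ky
    split 0 (suc (suc (suc _))) _ _ _ (s≤s (s≤s ())) _
    split 1 (suc (suc (suc _))) _ _ _ (s≤s (s≤s ())) _
    split 2 (suc (suc (suc _))) _ _ _ (s≤s (s≤s ())) _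
    split (suc (suc (suc _))) _ _ _ (s≤s (s≤s ())) _ _
    split 0 0 _ _ _ _ ()
    split 0 1 _ _ _ _ (s≤s ())
    split 0 2 _ _ _ _ (s≤s (s≤s ()))
    split 1 0 _ _ _ _ (s≤s ())
    split 1 1 _ _ _ _ (s≤s (s≤s ()))
    split 2 0 _ _ _ _ (s≤s (s≤s ()))

-- Paths whose steps are all parallel

module _ {m} {r : RankFn m} {L R : Subset m} where

  -- With two steps the pair is `⊤`; with three, `K ⊤` lies between 2 and 3. With four or more, the
  -- complements of steps 0 and 1 have `K` at most 2 by `cross`, their intersection contains the
  -- pair of steps 2 and 3, and submodularity gives `K ⊤` at most 2.
  ⊓*L⊤ : ∀ {n} {Q : Fin (2 + n) → Subset m} (u : UnitProfile r L R Q) → let open UnitProfile u in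
    (∀ i j → i ≢ j → K (⁅ i ⁆ ∪ ⁅ j ⁆) ≡ 2) → K ⊤ ≡ 2 ⊎ (2 + n ≡ 3 × K ⊤ ≡ 3)
  ⊓*L⊤ {zero} u Kij≡2 = inj₁ (Kij≡2 zero (suc zero) λ ())
  ⊓*L⊤ {suc zero} u Kij≡2 with 2or3 {K ⊤} (≤-trans (≤-reflexive (sym (Kij≡2 zero (suc zero) λ ()))) (K-mono ⊆⊤)) (G≤3 (dualProfile base) ⊤)
    where
    open UnitProfile u
    open Facts
  ... | inj₁ K⊤≡2 = inj₁ K⊤≡2
  ... | inj₂ K⊤≡3 = inj₂ (refl , K⊤≡3)
  ⊓*L⊤ {suc (suc n)} u Kij≡2 = inj₁ (≤-antisym K⊤≤2 (≤-trans 2≤K∩ (K-mono ⊆⊤)))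
    where
    open UnitProfile u
    X Y : Subset (4 + n)
    X = ∁ ⁅ zero ⁆
    Y = ∁ ⁅ suc zero ⁆
    K∁≤2 : ∀ i → K (∁ ⁅ i ⁆) ≤ 2
    K∁≤2 i = m+n≤o⇒n≤o∸m (subst (λ x → x + K (∁ ⁅ i ⁆) ≤ 3) (G≡1 i) (cross ⁅ i ⁆))
    2≤K∩ : 2 ≤ K (X ∩ Y)
    2≤K∩ = ≤-trans (≤-reflexive (sym (Kij≡2 (suc (suc zero)) (suc (suc (suc zero))) λ ())))
      (K-mono (∪-lub (⁅⁆⊆ (x∈p∩q⁺ {p = X} {Y} (there (there here) , there (there here))))
                     (⁅⁆⊆ (x∈p∩q⁺ {p = X} {Y} (there (there (there here)) , there (there (there here)))))))
    X∪Y≡⊤ : X ∪ Y ≡ ⊤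
    X∪Y≡⊤ = trans (sym (∁-∩ ⁅ zero ⁆ ⁅ suc zero ⁆)) (trans (cong ∁ (⁅⁆-∩ {i = zero} {suc zero} λ ())) ∁⊥≡⊤)
    K⊤≤2 : K ⊤ ≤ 2
    K⊤≤2 = +-cancelʳ-≤ 2 _ _ (begin
      K ⊤ + 2                 ≤⟨ +-monoʳ-≤ (K ⊤) 2≤K∩ ⟩
      K ⊤ + K (X ∩ Y)         ≡⟨ cong (λ Z → K Z + K (X ∩ Y)) X∪Y≡⊤ ⟨
      K (X ∪ Y) + K (X ∩ Y)   ≤⟨ K-sub X Y ⟩
      K X + K Y               ≤⟨ +-mono-≤ (K∁≤2 zero) (K∁≤2 (suc zero)) ⟩
      4                       ∎)
      where open ≤-Reasoning

  -- `G` is 1 on every nonempty set, so `pair` forces `K` to be 2 on pairs; the value of `K ⊤` then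
  -- separates the spike from its relaxation.
  parallel⇒spike : ∀ {n} {Q : Fin (2 + n) → Subset m} (u : UnitProfile r L R Q) →
    UnitProfile.G u ⊤ ≤ 1 → SpikeReminiscent r L Q R ⊎ RelaxedSpikeReminiscent r L Q R
  parallel⇒spike u G⊤≤1 = conclude (⊓*L⊤ u Kij≡2)
    where
    open UnitProfile u
    open Unit u hiding (G⊤≤1)
    G⊤≡1 : G ⊤ ≡ 1
    G⊤≡1 = ≤-antisym G⊤≤1 (1≤G {i = zero} ∈⊤)
    Gij≡1 : ∀ i j → G ⟨ i , j ⟩ ≡ 1
    Gij≡1 i j = ≤-antisym (≤-trans (G-mono ⊆⊤) G⊤≤1) (1≤G (p⊆p∪q _ (x∈⁅x⁆ i)))
    Kij≡2 : ∀ i j → i ≢ j → K ⟨ i , j ⟩ ≡ 2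
    Kij≡2 i j i≢j = ≤-antisym (Kij≤2 i j) (m+n≤o⇒n≤o∸m {1}
      (≤-trans (pair i j i≢j) (+-monoˡ-≤ (K ⟨ i , j ⟩) (≤-reflexive (Gij≡1 i j)))))
    pairs : Pairs r _ 1 0
    pairs i j i≢j = pairIs i≢j (Gij≡1 i j) (Kij≡2 i j i≢j)
    conclude : K ⊤ ≡ 2 ⊎ (_ × K ⊤ ≡ 3) → _
    conclude (inj₁ K⊤≡2)       = inj₁ (LR-is K⊤≡2 G⊤≡1 , pairs , condB)
    conclude (inj₂ (n≡ , K⊤≡3)) = inj₂ (n≡ , LR-is K⊤≡3 G⊤≡1 , pairs , condB)

-- The outcomes when some pair is parallel; a coparallel pair gives the same list for `dualRank r`.
data Spikelike {m n} (r : RankFn m) (L : Subset m) (Q : Fin n → Subset m) (R : Subset m) : Set where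
  spike         : SpikeReminiscent r L Q R → Spikelike r L Q R
  relaxed-spike : RelaxedSpikeReminiscent r L Q R → Spikelike r L Q R
  vámos         : VamosCond r L Q R → Spikelike r L Q R
  nasty         : Nasty r L Q R → Spikelike r L Q R

-- The outcomes for three mutually skew steps. Only the tightened prism comes in two versions
-- exchanged by duality.
data Prismlike {m n} (r : RankFn m) (L : Subset m) (Q : Fin n → Subset m) (R : Subset m) : Set where
  prism            : PrismLike r L Q R → Prismlike r L Q R
  tightened        : TightenedPrismLike r L Q R → Prismlike r L Q R
  tightened*       : TightenedPrismLike (dualRank r) L Q R → Prismlike r L Q R
  doubly-tightened : DoublyTightenedPrismLike r L Q R → Prismlike r L Q R

-- Three steps

module _ {m} {r : RankFn m} {L R : Subset m} {Q : Fin 3 → Subset m} (u : UnitProfile r L R Q) where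
  open UnitProfile u
  open Unit u
  private module D = Unit (dualUnitProfile u)

  -- The labelling is arbitrary so that any of the three pairs can serve as the distinguished pair
  -- `j`, `k`.
  module _ (i j k : Fin 3) (i≢j : i ≢ j) (i≢k : i ≢ k) (j≢k : j ≢ k)
    (exhaust : ∀ a → a ≡ i ⊎ a ≡ j ⊎ a ≡ k) where

    all-pairs : ∀ {P : Fin 3 → Fin 3 → Set} → (∀ {a b} → P a b → P b a) → P i j → P i k → P j k →
      ∀ a b → a ≢ b → P a b
    all-pairs P-sym ij ik jk a b a≢b with exhaust a | exhaust b
    ... | inj₁ refl        | inj₁ refl        = contradiction refl a≢b
    ... | inj₁ refl        | inj₂ (inj₁ refl) = ij
    ... | inj₁ refl        | inj₂ (inj₂ refl) = ik
    ... | inj₂ (inj₁ refl) | inj₁ refl        = P-sym ij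
    ... | inj₂ (inj₁ refl) | inj₂ (inj₁ refl) = contradiction refl a≢b
    ... | inj₂ (inj₁ refl) | inj₂ (inj₂ refl) = jk
    ... | inj₂ (inj₂ refl) | inj₁ refl        = P-sym ik
    ... | inj₂ (inj₂ refl) | inj₂ (inj₁ refl) = P-sym jk
    ... | inj₂ (inj₂ refl) | inj₂ (inj₂ refl) = contradiction refl a≢b

    private
      parallel-class : ∀ {c} → Parallel c i → Parallel c j → Parallel c k → Spikelike r L Q R
      parallel-class {c} ci cj ck = [ spike , relaxed-spike ]′ (parallel⇒spike u (G⊤≤1 c par))
        where
        par : ∀ b → Parallel c b
        par b with exhaust b
        ... | inj₁ refl        = ci
        ... | inj₂ (inj₁ refl) = cj
        ... | inj₂ (inj₂ refl) = ck

      ⊤⊆ : ∀ {a b c} → (∀ x → x ≡ a ⊎ x ≡ b ⊎ x ≡ c) → ⊤ ⊆ ⁅ a ⁆ ∪ ⟨ b , c ⟩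
      ⊤⊆ {a} {b} {c} ex {x} _ with ex x
      ... | inj₁ refl        = p⊆p∪q _ (x∈⁅x⁆ x)
      ... | inj₂ (inj₁ refl) = q⊆p∪q ⁅ a ⁆ _ (p⊆p∪q _ (x∈⁅x⁆ x))
      ... | inj₂ (inj₂ refl) = q⊆p∪q ⁅ a ⁆ _ (q⊆p∪q ⁅ b ⁆ _ (x∈⁅x⁆ x))

      rotate : ∀ a → a ≡ j ⊎ a ≡ i ⊎ a ≡ k
      rotate a with exhaust a
      ... | inj₁ e        = inj₂ (inj₁ e)
      ... | inj₂ (inj₁ e) = inj₁ e
      ... | inj₂ (inj₂ e) = inj₂ (inj₂ e)

      rotate′ : ∀ a → a ≡ k ⊎ a ≡ i ⊎ a ≡ j
      rotate′ a with exhaust a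
      ... | inj₁ e        = inj₂ (inj₁ e)
      ... | inj₂ (inj₁ e) = inj₂ (inj₂ e)
      ... | inj₂ (inj₂ e) = inj₁ e

      module _ (Gjk : G ⟨ j , k ⟩ ≡ 1) (Kjk : K ⟨ j , k ⟩ ≡ 2) where

        G⊤≡2 : G ⟨ i , j ⟩ ≡ 2 → G ⊤ ≡ 2
        G⊤≡2 Gij = ≤-antisym
          (≤-trans (G-cover ⁅ i ⁆ ⟨ j , k ⟩ (⊤⊆ exhaust)) (≤-reflexive (cong₂ _+_ (G≡1 i) Gjk)))
          (≤-trans (≤-reflexive (sym Gij)) (G-mono ⊆⊤))

        2≤K⊤ : 2 ≤ K ⊤
        2≤K⊤ = ≤-trans (≤-reflexive (sym Kjk)) (K-mono ⊆⊤)

        -- A coparallel pair and the third step bound `K ⊤` by 2. The second labelling is there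
        -- because the coparallel pair differs from `j`, `k`.
        K⊤≡2 : ∀ {a b c} → (∀ x → x ≡ a ⊎ x ≡ b ⊎ x ≡ c) → K ⟨ b , c ⟩ ≡ 1 → K ⊤ ≡ 2
        K⊤≡2 {a} {b} {c} ex Kbc = ≤-antisym
          (≤-trans (K-cover ⁅ a ⁆ ⟨ b , c ⟩ (⊤⊆ ex)) (≤-reflexive (cong₂ _+_ (K≡1 a) Kbc))) 2≤K⊤

    -- A second parallel pair makes all steps parallel. Two coparallel pairs would make `j`, `k`
    -- coparallel, contrary to `K ⟨ j , k ⟩ ≡ 2`. One coparallel and one skew pair is nasty; for two
    -- skew pairs, `K ⊤` decides between nasty (2) and Vámos (3).
    one-parallel : G ⟨ j , k ⟩ ≡ 1 → K ⟨ j , k ⟩ ≡ 2 → PairType i j → PairType i k → Spikelike r L Q R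
    one-parallel Gjk Kjk (parallel Gij _) _ = parallel-class (Parallel-sym Gij) Parallel-refl Gjk
    one-parallel Gjk Kjk _ (parallel Gik _) = parallel-class (Parallel-sym Gik) (Parallel-sym Gjk) Parallel-refl
    one-parallel Gjk Kjk (coparallel _ Kij) (coparallel _ Kik) =
      contradiction (trans (sym (D.Parallel-join Kij Kik)) Kjk) λ ()
    one-parallel Gjk Kjk (skew Gij Kij) (coparallel Gik Kik) = nasty
      (refl , LR-is (K⊤≡2 Gjk Kjk rotate Kik) (G⊤≡2 Gjk Kjk Gij) , condB , i , j , k , (i≢j , i≢k , j≢k) ,
        inj₁ (pairIs i≢j Gij Kij , pairIs i≢k Gik Kik , pairIs j≢k Gjk Kjk))
    one-parallel Gjk Kjk (coparallel Gij Kij) (skew Gik Kik) = nasty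
      (refl , LR-is (K⊤≡2 Gjk Kjk rotate′ Kij) (G⊤≡2 Gjk Kjk Gij) , condB , i , k , j , (i≢k , i≢j , k≢j) ,
        inj₁ (pairIs i≢k Gik Kik , pairIs i≢j Gij Kij ,
          pairIs k≢j (Parallel-sym Gjk) (trans (cong K (∪-comm ⁅ k ⁆ ⁅ j ⁆)) Kjk)))
      where
      k≢j : k ≢ j
      k≢j = j≢k ∘ sym
    one-parallel Gjk Kjk (skew Gij Kij) (skew Gik Kik) with 2or3 (2≤K⊤ Gjk Kjk) (D.G≤3 ⊤)
    ... | inj₁ K⊤≡2 = nasty
      (refl , LR-is K⊤≡2 (G⊤≡2 Gjk Kjk Gij) , condB , i , j , k , (i≢j , i≢k , j≢k) ,
        inj₂ (inj₁ (pairIs i≢j Gij Kij , pairIs i≢k Gik Kik , pairIs j≢k Gjk Kjk)))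
    ... | inj₂ K⊤≡3 = vámos
      (refl , LR-is K⊤≡3 (G⊤≡2 Gjk Kjk Gij) , condB ,
        all-pairs (λ {a} {b} → trans (lc-comm (dualRank r) (Q b) (Q a)))
          (proj₂ (pairIs i≢j Gij Kij)) (proj₂ (pairIs i≢k Gik Kik)) (proj₂ (pairIs j≢k Gjk Kjk)) ,
        i , j , k , (i≢j , i≢k , j≢k) ,
        proj₁ (pairIs i≢j Gij Kij) , proj₁ (pairIs i≢k Gik Kik) , proj₁ (pairIs j≢k Gjk Kjk))

module _ {m} {r : RankFn m} {L R : Subset m} where

  module _ {Q : Fin 3 → Subset m} (u : UnitProfile r L R Q) where
    open UnitProfile u
    open Unit u
    private
      u* = dualUnitProfile u
      module D = Unit u*

      flip : ∀ {i j} → PairType i j → D.PairType i j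
      flip (parallel g k)   = D.coparallel k g
      flip (coparallel g k) = D.parallel k g
      flip (skew g k)       = D.skew k g

      012-exhaust : (a : Fin 3) → a ≡ 0F ⊎ a ≡ 1F ⊎ a ≡ 2F
      012-exhaust 0F = inj₁ refl
      012-exhaust 1F = inj₂ (inj₁ refl)
      012-exhaust 2F = inj₂ (inj₂ refl)

      102-exhaust : (a : Fin 3) → a ≡ 1F ⊎ a ≡ 0F ⊎ a ≡ 2F
      102-exhaust 0F = inj₂ (inj₁ refl)
      102-exhaust 1F = inj₁ refl
      102-exhaust 2F = inj₂ (inj₂ refl)

      201-exhaust : (a : Fin 3) → a ≡ 2F ⊎ a ≡ 0F ⊎ a ≡ 1F
      201-exhaust 0F = inj₂ (inj₁ refl)
      201-exhaust 1F = inj₂ (inj₂ refl)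
      201-exhaust 2F = inj₁ refl

      all-skew : (∀ i j → i ≢ j → G ⟨ i , j ⟩ ≡ 2 × K ⟨ i , j ⟩ ≡ 2) → Prismlike r L Q R
      all-skew Gij = split (2or3 2≤K⊤ (D.G≤3 ⊤)) (2or3 2≤G⊤ (G≤3 ⊤))
        where
        2≤G⊤ : 2 ≤ G ⊤
        2≤G⊤ = ≤-trans (≤-reflexive (sym (proj₁ (Gij 0F 1F λ ())))) (G-mono ⊆⊤)
        2≤K⊤ : 2 ≤ K ⊤
        2≤K⊤ = ≤-trans (≤-reflexive (sym (proj₂ (Gij 0F 1F λ ())))) (K-mono ⊆⊤)
        pairs : Pairs r Q 0 0
        pairs i j i≢j = let g , k = Gij i j i≢j in pairIs i≢j g k
        pairs* : Pairs (dualRank r) Q 0 0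
        pairs* i j i≢j = let g , k = Gij i j i≢j in D.pairIs i≢j k g
        split : K ⊤ ≡ 2 ⊎ K ⊤ ≡ 3 → G ⊤ ≡ 2 ⊎ G ⊤ ≡ 3 → Prismlike r L Q R
        split (inj₁ k) (inj₁ g) = doubly-tightened (refl , pairs , LR-is k g , condB)
        split (inj₂ k) (inj₁ g) = tightened (refl , pairs , LR-is k g , condB)
        split (inj₁ k) (inj₂ g) = tightened* (refl , pairs* , D.LR-is g k , D.condB)
        split (inj₂ k) (inj₂ g) = prism (refl , pairs , LR-is k g , condB)

    three-steps : Spikelike r L Q R ⊎ Spikelike (dualRank r) L Q R ⊎ Prismlike r L Q R
    three-steps with pairType 0F 1F (λ ()) | pairType 0F 2F (λ ()) | pairType 1F 2F (λ ())
    ... | t₀₁ | t₀₂ | parallel g k =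
      inj₁ (one-parallel u 0F 1F 2F (λ ()) (λ ()) (λ ()) 012-exhaust g k t₀₁ t₀₂)
    ... | t₀₁ | t₀₂ | coparallel g k =
      inj₂ (inj₁ (one-parallel u* 0F 1F 2F (λ ()) (λ ()) (λ ()) 012-exhaust k g (flip t₀₁) (flip t₀₂)))
    ... | t₀₁ | parallel g k | t₁₂ =
      -- The relabelling needs the pair in the order 1, 0, the reverse of `t₀₁`, so its type is
      -- determined afresh.
      inj₁ (one-parallel u 1F 0F 2F (λ ()) (λ ()) (λ ()) 102-exhaust g k (pairType 1F 0F λ ()) t₁₂)
    ... | t₀₁ | coparallel g k | t₁₂ =
      inj₂ (inj₁ (one-parallel u* 1F 0F 2F (λ ()) (λ ()) (λ ()) 102-exhaust k g (D.pairType 1F 0F λ ()) (flip t₁₂)))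
    ... | parallel g k | _ | _ =
      inj₁ (one-parallel u 2F 0F 1F (λ ()) (λ ()) (λ ()) 201-exhaust g k (pairType 2F 0F λ ()) (pairType 2F 1F λ ()))
    ... | coparallel g k | _ | _ =
      inj₂ (inj₁ (one-parallel u* 2F 0F 1F (λ ()) (λ ()) (λ ()) 201-exhaust k g (D.pairType 2F 0F λ ()) (D.pairType 2F 1F λ ())))
    ... | skew g₀₁ k₀₁ | skew g₀₂ k₀₂ | skew g₁₂ k₁₂ =
      inj₂ (inj₂ (all-skew (all-pairs u 0F 1F 2F (λ ()) (λ ()) (λ ()) 012-exhaust
        (λ {a} {b} (g , k) → trans (cong G (∪-comm ⁅ b ⁆ ⁅ a ⁆)) g , trans (cong K (∪-comm ⁅ b ⁆ ⁅ a ⁆)) k)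
        (g₀₁ , k₀₁) (g₀₂ , k₀₂) (g₁₂ , k₁₂))))

  -- Four or more steps

  module _ {n} {Q : Fin (4 + n) → Subset m} (u : UnitProfile r L R Q) where
    open UnitProfile u
    open Unit u
    private
      u* = dualUnitProfile u
      module D = Unit u*

    -- A pair with `G` and `K` both 2 leaves, by `cross` and its dual, at most 1 for each on the
    -- complement. Two further steps lie there, and `pair` gives them a total of at least 3.
    no-skew : ∀ i j → i ≢ j → ¬ (G ⟨ i , j ⟩ ≡ 2 × K ⟨ i , j ⟩ ≡ 2)
    no-skew i j i≢j (Gij , Kij) = contradiction
      (≤-trans (pair a b a≢b) (+-mono-≤ (≤-trans (G-mono ab⊆) G∁≤1) (≤-trans (K-mono ab⊆) K∁≤1)))
      λ { (s≤s (s≤s ())) }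
      where
      -- `j′` is the position of `j` after `i` is removed; `a` and `b` are the first two steps that
      -- remain after removing both.
      j′ : Fin (3 + n)
      j′ = punchOut i≢j
      a b : Fin (4 + n)
      a = punchIn i (punchIn j′ 0F)
      b = punchIn i (punchIn j′ 1F)
      a≢b : a ≢ b
      a≢b a≡b = contradiction (punchIn-injective j′ 0F 1F (punchIn-injective i _ _ a≡b)) λ ()
      ∈∁ij : ∀ x → punchIn i (punchIn j′ x) ∈ ∁ ⟨ i , j ⟩
      ∈∁ij x = x∉p⇒x∈∁p λ x∈ → excluded (x∈p∪q⁻ ⁅ i ⁆ ⁅ j ⁆ x∈)
        where
        excluded : _ ⊎ _ → _
        excluded (inj₁ ∈i) = punchInᵢ≢i i _ (x∈⁅y⁆⇒x≡y i ∈i)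
        excluded (inj₂ ∈j) = punchInᵢ≢i j′ x
          (punchIn-injective i _ _ (trans (x∈⁅y⁆⇒x≡y j ∈j) (sym (punchIn-punchOut i≢j))))
      ab⊆ : ⟨ a , b ⟩ ⊆ ∁ ⟨ i , j ⟩
      ab⊆ = ∪-lub (⁅⁆⊆ (∈∁ij 0F)) (⁅⁆⊆ (∈∁ij 1F))
      K∁≤1 : K (∁ ⟨ i , j ⟩) ≤ 1
      K∁≤1 = m+n≤o⇒n≤o∸m (subst (λ x → x + K (∁ ⟨ i , j ⟩) ≤ 3) Gij (cross ⟨ i , j ⟩))
      G∁≤1 : G (∁ ⟨ i , j ⟩) ≤ 1
      G∁≤1 = m+n≤o⇒n≤o∸m (subst (λ x → x + G (∁ ⟨ i , j ⟩) ≤ 3) Kij (Profile.cross (dualProfile base) ⟨ i , j ⟩))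

    -- Suppose `b` is coparallel to step 0. If it is parallel to step 1, transitivity makes it
    -- parallel to step 0 too; if coparallel, dual transitivity makes steps 0 and 1 coparallel,
    -- contradicting `K₀₁`.
    parallel-spreads : G ⟨ 0F , 1F ⟩ ≡ 1 → K ⟨ 0F , 1F ⟩ ≡ 2 → ∀ b → Parallel 0F b
    parallel-spreads G₀₁ K₀₁ 0F = Parallel-refl {0F}
    parallel-spreads G₀₁ K₀₁ 1F = G₀₁
    parallel-spreads G₀₁ K₀₁ b@(suc (suc _)) with pairType 0F b (λ ()) | pairType 1F b (λ ())
    ... | parallel g _   | _              = g
    ... | skew g k       | _              = contradiction (g , k) (no-skew 0F b λ ())
    ... | _              | skew g k       = contradiction (g , k) (no-skew 1F b λ ())
    ... | coparallel _ _ | parallel g _   = Parallel-join {1F} {0F} {b} (Parallel-sym {0F} {1F} G₀₁) g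
    ... | coparallel _ k | coparallel _ l =
      contradiction (trans (sym (D.Parallel-join {b} {0F} {1F} (D.Parallel-sym {0F} {b} k) (D.Parallel-sym {1F} {b} l))) K₀₁) λ ()

module _ {m} {r : RankFn m} {L R : Subset m} where

  many-steps : ∀ {n} {Q : Fin (4 + n) → Subset m} → UnitProfile r L R Q →
    Spikelike r L Q R ⊎ Spikelike (dualRank r) L Q R
  many-steps u with Unit.pairType u 0F 1F (λ ())
  ... | Unit.parallel g k =
    inj₁ ([ spike , relaxed-spike ]′ (parallel⇒spike u (Unit.G⊤≤1 u 0F (parallel-spreads u g k))))
  ... | Unit.coparallel g k = let u* = dualUnitProfile u in
    inj₂ ([ spike , relaxed-spike ]′ (parallel⇒spike u* (Unit.G⊤≤1 u* 0F (parallel-spreads u* k g))))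
  ... | Unit.skew g k = contradiction (g , k) (no-skew u 0F 1F λ ())

  two-steps : {Q : Fin 2 → Subset m} → UnitProfile r L R Q →
    Spikelike r L Q R ⊎ Spikelike (dualRank r) L Q R ⊎ (Pairs r Q 0 0 × LRis r L R 1 1)
  two-steps {Q} u with Unit.pairType u 0F 1F (λ ())
  -- With only two steps, the pair `⁅ 0F ⁆ ∪ ⁅ 1F ⁆` computes to `⊤`, so `g` already bounds `G ⊤`.
  ... | Unit.parallel g k   = inj₁ ([ spike , relaxed-spike ]′ (parallel⇒spike u (≤-reflexive g)))
  ... | Unit.coparallel g k = inj₂ (inj₁ ([ spike , relaxed-spike ]′ (parallel⇒spike (dualUnitProfile u) (≤-reflexive k))))
  ... | Unit.skew g k       = inj₂ (inj₂ (pairs , LR-is k g))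
    where
    open Unit u
    pairs : Pairs r Q 0 0
    pairs 0F 0F i≢j = contradiction refl i≢j
    pairs 0F 1F i≢j = pairIs i≢j g k
    pairs 1F 0F i≢j = pairIs i≢j g k
    pairs 1F 1F i≢j = contradiction refl i≢j

-- Outcomes in the dual read back in the matroid

module _ {m n} {r : RankFn m} {L R : Subset m} {Q : Fin n → Subset m} (p : Profile r L R Q) where
  open Profile p

  private
    undual : ∀ {X Y a} → lc* (dualRank r) X Y ≡ a → lc r X Y ≡ a
    undual = trans (sym (lc**≡lc _ _))

  LRis-dual : ∀ {a b} → LRis (dualRank r) L R a b → LRis r L R b a
  LRis-dual (x , y) = undual y , x

  Pairs-dual : ∀ {a b} → Pairs (dualRank r) Q a b → Pairs r Q b a
  Pairs-dual ps i j i≢j = let x , y = ps i j i≢j in undual y , x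

  CondB-dual : CondB (dualRank r) L Q R → CondB r L Q R
  CondB-dual cs i = let a , b , c , d = cs i in undual c , undual d , a , b

  Squashed-dual : Squashed (dualRank r) L Q R → Stretched r L Q R
  Squashed-dual (lr , ps , cs) = LRis-dual lr , Pairs-dual ps ,
    λ i → let a , b , c , d = cs i in undual c , undual d , a , b

  Spike-dual : SpikeReminiscent (dualRank r) L Q R → PaddleReminiscent r L Q R
  Spike-dual (lr , ps , cs) = LRis-dual lr , Pairs-dual ps , CondB-dual cs

  Paddle-dual : PaddleReminiscent (dualRank r) L Q R → SpikeReminiscent r L Q R
  Paddle-dual (lr , ps , cs) = LRis-dual lr , Pairs-dual ps , CondB-dual cs

  RelaxedSpike-dual : RelaxedSpikeReminiscent (dualRank r) L Q R → RelaxedPaddleReminiscent r L Q R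
  RelaxedSpike-dual (n≡3 , lr , ps , cs) = n≡3 , LRis-dual lr , Pairs-dual ps , CondB-dual cs

  RelaxedPaddle-dual : RelaxedPaddleReminiscent (dualRank r) L Q R → RelaxedSpikeReminiscent r L Q R
  RelaxedPaddle-dual (n≡3 , lr , ps , cs) = n≡3 , LRis-dual lr , Pairs-dual ps , CondB-dual cs

-- Paths without specially placed steps

record OrdinaryOutcome {m n} (r : RankFn m) (L : Subset m) (Q : Fin n → Subset m) (R : Subset m) : Set where
  constructor outcome
  field
    alternatives :
      (Squashed r L Q R ⊎ Stretched r L Q R ⊎ PaddleReminiscent r L Q R ⊎ SpikeReminiscent r L Q R)
      ⊎ (n ≡ 3 ×
          (InMOrDual PrismLike r L Q R ⊎ InMOrDual TightenedPrismLike r L Q R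
           ⊎ InMOrDual DoublyTightenedPrismLike r L Q R
           ⊎ InMOrDual RelaxedSpikeReminiscent r L Q R
           ⊎ InMOrDual VamosInspired r L Q R ⊎ InMOrDual Nasty r L Q R))
      ⊎ (n ≡ 2 × (∀ i j → i ≢ j → PairIs r Q i j 0 0) × LRis r L R 1 1)

module _ {m n} {r : RankFn m} {L R : Subset m} {Q : Fin n → Subset m} where

  spikelike⇒outcome : Spikelike r L Q R → OrdinaryOutcome r L Q R
  spikelike⇒outcome (spike x)         = outcome (inj₁ (inj₂ (inj₂ (inj₂ x))))
  spikelike⇒outcome (relaxed-spike x) = outcome (inj₂ (inj₁ (proj₁ x , inj₂ (inj₂ (inj₂ (inj₁ (inj₁ x)))))))
  spikelike⇒outcome (vámos x)         = outcome (inj₂ (inj₁ (proj₁ x , inj₂ (inj₂ (inj₂ (inj₂ (inj₁ (inj₁ (inj₁ x)))))))))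
  spikelike⇒outcome (nasty x)         = outcome (inj₂ (inj₁ (proj₁ x , inj₂ (inj₂ (inj₂ (inj₂ (inj₂ (inj₁ x))))))))

  spikelike*⇒outcome : Profile r L R Q → Spikelike (dualRank r) L Q R → OrdinaryOutcome r L Q R
  spikelike*⇒outcome p (spike x)         = outcome (inj₁ (inj₂ (inj₂ (inj₁ (Spike-dual p x)))))
  spikelike*⇒outcome p (relaxed-spike x) = outcome (inj₂ (inj₁ (proj₁ x , inj₂ (inj₂ (inj₂ (inj₁ (inj₂ x)))))))
  spikelike*⇒outcome p (vámos x)         = outcome (inj₂ (inj₁ (proj₁ x , inj₂ (inj₂ (inj₂ (inj₂ (inj₁ (inj₁ (inj₂ x)))))))))
  spikelike*⇒outcome p (nasty x)         = outcome (inj₂ (inj₁ (proj₁ x , inj₂ (inj₂ (inj₂ (inj₂ (inj₂ (inj₂ x))))))))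

  prismlike⇒outcome : Prismlike r L Q R → OrdinaryOutcome r L Q R
  prismlike⇒outcome (prism x)            = outcome (inj₂ (inj₁ (proj₁ x , inj₁ (inj₁ x))))
  prismlike⇒outcome (tightened x)        = outcome (inj₂ (inj₁ (proj₁ x , inj₂ (inj₁ (inj₁ x)))))
  prismlike⇒outcome (tightened* x)       = outcome (inj₂ (inj₁ (proj₁ x , inj₂ (inj₁ (inj₂ x)))))
  prismlike⇒outcome (doubly-tightened x) = outcome (inj₂ (inj₁ (proj₁ x , inj₂ (inj₂ (inj₁ (inj₁ x))))))

unit-outcome : ∀ n {m} {r : RankFn m} {L R} {Q : Fin (2 + n) → Subset m} → UnitProfile r L R Q → OrdinaryOutcome r L Q R
unit-outcome 0 u = let p = UnitProfile.base u in
  [ spikelike⇒outcome , [ spikelike*⇒outcome p , (λ x → outcome (inj₂ (inj₂ (refl , x)))) ]′ ]′ (two-steps u)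
unit-outcome 1 u = let p = UnitProfile.base u in
  [ spikelike⇒outcome , [ spikelike*⇒outcome p , prismlike⇒outcome ]′ ]′ (three-steps u)
unit-outcome (suc (suc n)) u = let p = UnitProfile.base u in
  [ spikelike⇒outcome , spikelike*⇒outcome p ]′ (many-steps u)

unit-weight : ∀ {x y} → x + y ≡ 2 → x ≢ 2 → y ≢ 2 → x ≡ 1
unit-weight {0} eq _ y≢2 = contradiction eq y≢2
unit-weight {1} _  _ _   = refl
unit-weight {2} _ x≢2 _  = contradiction refl x≢2

ordinary-outcome : ∀ {m n} {r : RankFn m} {L R} {Q : Fin (2 + n) → Subset m} → Profile r L R Q →
  (∀ i → ¬ SpeciallyPlacedS1 r L Q R i × ¬ SpeciallyPlacedS2 r L Q R i) → OrdinaryOutcome r L Q R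
ordinary-outcome {n = n} {r} {L} {R} {Q} p ordinary
  with any? (λ i → Profile.G p ⁅ i ⁆ ≟ 2) | any? (λ i → Profile.K p ⁅ i ⁆ ≟ 2)
-- If the ends had local connectivity 2, step `i` would be specially placed of type (S1).
... | yes (i , Gi≡2) | _ = outcome (inj₁ (inj₁ (squashed p Gi≡2 λ lc≡2 → proj₁ (ordinary i)
  (lc≡2 , trans (lc-comm r L (Q i)) (trans (lc-QL i) Gi≡2) , trans (lc-comm r R (Q i)) (trans (lc-QR i) Gi≡2)))))
  where open Profile p
... | no _ | yes (i , Ki≡2) = outcome (inj₁ (inj₂ (inj₁ (Squashed-dual p (squashed (dualProfile p) Ki≡2 λ lc*≡2 → proj₂ (ordinary i)
  (lc*≡2 , trans (lc-comm (dualRank r) L (Q i)) (trans (lc*-QL i) Ki≡2) ,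
    trans (lc-comm (dualRank r) R (Q i)) (trans (lc*-QR i) Ki≡2)))))))
  where open Profile p
... | no G≢2 | no K≢2 = unit-outcome n record
  { base = p
  ; G≡1 = λ i → unit-weight (single i) (λ e → G≢2 (i , e)) (λ e → K≢2 (i , e))
  ; K≡1 = λ i → unit-weight (trans (+-comm (K ⁅ i ⁆) _) (single i)) (λ e → K≢2 (i , e)) (λ e → G≢2 (i , e))
  }
  where open Profile p

-- From paths of 4-separations to profiles

blocks-partition : ∀ {m n} {L R : Subset m} {Q : Fin n → Subset m} →
  Disjoint L R → (∀ i → Disjoint L (Q i)) → (∀ i → Disjoint (Q i) R) →
  (∀ i j {e} → e ∈ Q i → e ∈ Q j → i ≡ j) → (∀ e → e ∈ L ⊎ e ∈ R ⊎ ∃ λ i → e ∈ Q i) →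
  IsPartition (blocks L R Q)
blocks-partition {L = L} {R} {Q} LR LQ QR QQ cover = record { disjoint = λ {i} {j} → disj i j ; covers = covers }
  where
  disj : ∀ i j {e} → e ∈ blocks L R Q i → e ∈ blocks L R Q j → i ≡ j
  disj zero          zero          _ _  = refl
  disj zero          (suc zero)    x y  = contradiction y (LR x)
  disj zero          (suc (suc j)) x y  = contradiction y (LQ j x)
  disj (suc zero)    zero          x y  = contradiction x (LR y)
  disj (suc zero)    (suc zero)    _ _  = refl
  disj (suc zero)    (suc (suc j)) x y  = contradiction x (QR j y)
  disj (suc (suc i)) zero          x y  = contradiction x (LQ i y)
  disj (suc (suc i)) (suc zero)    x y  = contradiction y (QR i x)
  disj (suc (suc i)) (suc (suc j)) x y  = cong (λ k → suc (suc k)) (QQ i j x y)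
  covers : ∀ e → ∃ λ i → e ∈ blocks L R Q i
  covers e with cover e
  ... | inj₁ e∈L              = zero , e∈L
  ... | inj₂ (inj₁ e∈R)       = suc zero , e∈R
  ... | inj₂ (inj₂ (i , e∈Q)) = suc (suc i) , e∈Q

∈unionUpTo⁻ : ∀ {m n} (Q : Fin n → Subset m) k {e} → e ∈ unionUpTo Q k → ∃ λ i → toℕ i < k × e ∈ Q i
∈unionUpTo⁻ {n = zero}  Q k       e∈ = contradiction e∈ ∉⊥
∈unionUpTo⁻ {n = suc n} Q zero    e∈ = contradiction e∈ ∉⊥
∈unionUpTo⁻ {n = suc n} Q (suc k) e∈ with x∈p∪q⁻ (Q zero) _ e∈
... | inj₁ e∈Q = zero , z<s , e∈Q
... | inj₂ e∈⋃ = let i , i<k , e∈Q = ∈unionUpTo⁻ (Q ∘ suc) k e∈⋃ in suc i , s<s i<k , e∈Q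

∈unionUpTo⁺ : ∀ {m n} (Q : Fin n → Subset m) k {i e} → toℕ i < k → e ∈ Q i → e ∈ unionUpTo Q k
∈unionUpTo⁺ Q (suc k) {zero}  _         e∈ = x∈p∪q⁺ (inj₁ e∈)
∈unionUpTo⁺ Q (suc k) {suc i} (s<s i<k) e∈ = x∈p∪q⁺ (inj₂ (∈unionUpTo⁺ (Q ∘ suc) k i<k e∈))

punchIn-fromℕ : ∀ n (i : Fin n) → punchIn (fromℕ n) i ≡ inject₁ i
punchIn-fromℕ (suc n) zero    = refl
punchIn-fromℕ (suc n) (suc i) = cong suc (punchIn-fromℕ n i)

record Enumerates {n} (S : Subset n) (π : Permutation′ n) (k : ℕ) : Set where
  field
    k≤n     : k ≤ n
    sound   : ∀ i → toℕ i < k → π ⟨$⟩ʳ i ∈ S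
    complete : ∀ {i} → i ∈ S → ∃ λ j → toℕ j < k × π ⟨$⟩ʳ j ≡ i

-- By recursion on the bits: an element of `S` goes to the front of the ordering, an element outside
-- `S` to the very end, so the members of `S` fill the first `k` places.
enumerate : ∀ {n} (S : Subset n) → ∃ λ π → ∃ λ k → Enumerates S π k
enumerate [] = id , 0 , record { k≤n = z≤n ; sound = λ _ () ; complete = λ () }
enumerate (true ∷ S) with enumerate S
... | π , k , E = lift₀ π , suc k , record
  { k≤n      = s≤s k≤n
  ; sound    = λ { zero _ → here ; (suc i) (s<s i<k) → there (sound i i<k) }
  ; complete = λ { here → zero , z<s , refl
                 ; (there i∈S) → let j , j<k , eq = complete i∈S in suc j , s<s j<k , cong suc eq }
  }
  where open Enumerates E
enumerate {suc n} (false ∷ S) with enumerate S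
... | π , k , E = σ , k , record
  { k≤n      = m≤n⇒m≤1+n k≤n
  ; sound    = λ i i<k → sound′ (view i) i<k
  ; complete = λ { (there i∈S) → let j , j<k , eq = complete i∈S in
      inject₁ j , subst (_< k) (sym (toℕ-inject₁ j)) j<k , trans (σ-inject₁ j) (cong suc eq) }
  }
  where
  open Enumerates E
  -- The last position receives the new element `zero`; the earlier positions follow `π`, shifted by
  -- one.
  σ = insert (fromℕ n) zero π
  σ-inject₁ : ∀ j → σ ⟨$⟩ʳ inject₁ j ≡ suc (π ⟨$⟩ʳ j)
  σ-inject₁ j = trans (cong (σ ⟨$⟩ʳ_) (sym (punchIn-fromℕ n j))) (insert-punchIn (fromℕ n) zero π j)
  sound′ : ∀ {i} → View i → toℕ i < k → σ ⟨$⟩ʳ i ∈ false ∷ S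
  sound′ ‵fromℕ i<k = contradiction (≤-trans (subst (_< k) (toℕ-fromℕ n) i<k) k≤n) (<-irrefl refl)
  sound′ (‵inj₁ {i = j} _) i<k =
    subst (_∈ false ∷ S) (sym (σ-inject₁ j)) (there (sound j (subst (_< k) (toℕ-inject₁ j) i<k)))

flexipath : ∀ {m n} {r : RankFn m} {L R} {Q : Fin n → Subset m} → Is4cFlexipath 2 r L Q R → Flexipath r L R Q
flexipath {n = n} {r} {L} {R} {Q} (paths , steps , pairs) = record
  { partition = blocks-partition LR LQ QR QQ (λ e → cover (cov ∈⊤))
  ; flexible  = flexible
  ; conn-step = steps
  ; conn-pair = pairs
  }
  where
  P₀ = proj₁ (paths id)
  LR : Disjoint L R
  LR = proj₁ P₀
  LQ : ∀ i → Disjoint L (Q i)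
  LQ = proj₁ (proj₂ P₀)
  QR : ∀ i → Disjoint (Q i) R
  QR = proj₁ (proj₂ (proj₂ P₀))
  QQ : ∀ i j {e} → e ∈ Q i → e ∈ Q j → i ≡ j
  QQ i j e∈Qi e∈Qj with i ≟ᶠ j
  ... | yes i≡j = i≡j
  ... | no  i≢j = contradiction e∈Qj (proj₁ (proj₂ (proj₂ (proj₂ P₀))) i j i≢j e∈Qi)
  cov : ⊤ ⊆ L ∪ (unionUpTo Q n ∪ R)
  cov = proj₂ (proj₂ (proj₂ (proj₂ P₀)))
  cover : ∀ {e} → e ∈ L ∪ (unionUpTo Q n ∪ R) → e ∈ L ⊎ e ∈ R ⊎ ∃ λ i → e ∈ Q i
  cover e∈ with x∈p∪q⁻ L _ e∈
  ... | inj₁ e∈L = inj₁ e∈L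
  ... | inj₂ e∈′ with x∈p∪q⁻ (unionUpTo Q n) R e∈′
  ... | inj₁ e∈⋃ = let i , _ , e∈Q = ∈unionUpTo⁻ Q n e∈⋃ in inj₂ (inj₂ (i , e∈Q))
  ... | inj₂ e∈R = inj₂ (inj₁ e∈R)
  flexible : ∀ S → conn r (L ∪ ⋃[ S ] Q) ≡ 3
  flexible S with enumerate S
  -- `S` fills the first `k` places of the ordering `π`, so the required connectivity is the one at
  -- position `k` of that path.
  ... | π , k , E = trans (cong (λ X → conn r (L ∪ X)) ⋃≡) (proj₂ (proj₂ (paths π)) k k≤n)
    where
    open Enumerates E
    Qπ : Fin n → Subset _
    Qπ i = Q (π ⟨$⟩ʳ i)
    to : ⋃[ S ] Q ⊆ unionUpTo Qπ k
    to e∈ with ∈⋃⁻ S Q e∈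
    ... | i , i∈S , e∈Q with complete i∈S
    ... | j , j<k , refl = ∈unionUpTo⁺ Qπ k j<k e∈Q
    from : unionUpTo Qπ k ⊆ ⋃[ S ] Q
    from e∈ = let i , i<k , e∈Q = ∈unionUpTo⁻ Qπ k e∈ in ∈⋃⁺ S Q (sound i i<k) e∈Q
    ⋃≡ : ⋃[ S ] Q ≡ unionUpTo Qπ k
    ⋃≡ = ⊆-antisym to from

-- Absorbing the last step into R

⋃-initSteps : ∀ {m n} (S : Subset n) (Q : Fin (suc n) → Subset m) → ⋃[ S ] (initSteps Q) ≡ ⋃[ S ∷ʳ false ] Q
⋃-initSteps []          Q = refl
⋃-initSteps (true ∷ S)  Q = cong (Q zero ∪_) (⋃-initSteps S (Q ∘ suc))
⋃-initSteps (false ∷ S) Q = ⋃-initSteps S (Q ∘ suc)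

-- A set of remaining steps is a set of original steps that omits the last one, and `L` is
-- unchanged, so flexibility is inherited.
absorb-last : ∀ {m n} {r : RankFn m} {L R} {Q : Fin (suc n) → Subset m} →
  Flexipath r L R Q → Flexipath r L (lastStep Q ∪ R) (initSteps Q)
absorb-last {n = n} {r} {L} {R} {Q} F = record
  { partition = blocks-partition LR (λ i → LQ (inject₁ i)) QR (λ i j e∈ e∈′ → inject₁-injective (QQ e∈ e∈′)) cover
  ; flexible  = λ S → trans (cong (λ X → conn r (L ∪ X)) (⋃-initSteps S Q)) (flexible (S ∷ʳ false))
  ; conn-step = λ i → conn-step (inject₁ i)
  ; conn-pair = λ i j i≢j → conn-pair (inject₁ i) (inject₁ j) (i≢j ∘ inject₁-injective)
  }
  where
  open Flexipath F
  open IsPartition partition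
  LQ : ∀ i → Disjoint L (Q i)
  LQ i e∈L e∈Q with () ← disjoint {zero} {suc (suc i)} e∈L e∈Q
  QQ : ∀ {i j e} → e ∈ Q i → e ∈ Q j → i ≡ j
  QQ {i} {j} e∈ e∈′ = Fin-suc-injective (Fin-suc-injective (disjoint {suc (suc i)} {suc (suc j)} e∈ e∈′))
  LR : Disjoint L (lastStep Q ∪ R)
  LR e∈L e∈ with x∈p∪q⁻ (lastStep Q) R e∈
  ... | inj₁ e∈Q = LQ (fromℕ n) e∈L e∈Q
  ... | inj₂ e∈R with () ← disjoint {zero} {suc zero} e∈L e∈R
  QR : ∀ i → Disjoint (Q (inject₁ i)) (lastStep Q ∪ R)
  QR i e∈Q e∈ with x∈p∪q⁻ (lastStep Q) R e∈
  ... | inj₁ e∈last = fromℕ≢inject₁ (QQ e∈last e∈Q)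
  ... | inj₂ e∈R with () ← disjoint {suc (suc (inject₁ i))} {suc zero} e∈Q e∈R
  cover : ∀ e → e ∈ L ⊎ e ∈ lastStep Q ∪ R ⊎ ∃ λ i → e ∈ initSteps Q i
  cover e with covers e
  ... | zero , e∈L        = inj₁ e∈L
  ... | suc zero , e∈R    = inj₂ (inj₁ (x∈p∪q⁺ (inj₂ e∈R)))
  ... | suc (suc i) , e∈Q with view i
  ... | ‵fromℕ            = inj₂ (inj₁ (x∈p∪q⁺ (inj₁ e∈Q)))
  ... | ‵inj₁ {i = j} _   = inj₂ (inj₂ (j , e∈Q))

-- The hypothesis gives `K ⊤ ≡ 1`, so `other-steps` makes all remaining steps unit. Enlarging `R`
-- keeps its local connectivity to `L` at least 2, which bounds the new `K ⊤` by 1: in the dual, all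
-- remaining steps are parallel.
paddle-after-absorbing : ∀ {m k} (M : Matroid m) {L R : Subset m} {Q : Fin (suc k) → Subset m} → let r = rank M in
  Flexipath r L R Q → SpeciallyPlacedS1 r L Q R (lastStepIx k) → 3 ≤ suc k →
  PaddleReminiscent r L (initSteps Q) (lastStep Q ∪ R) ⊎ RelaxedPaddleReminiscent r L (initSteps Q) (lastStep Q ∪ R)
paddle-after-absorbing {k = 1} M F _ (s≤s (s≤s ()))
paddle-after-absorbing {k = suc (suc n)} M {L} {R} {Q} F (lc-LR≡2 , lc-LQ≡2 , _) _ =
  [ inj₁ ∘ Spike-dual p′ , inj₂ ∘ RelaxedSpike-dual p′ ]′ (parallel⇒spike (dualUnitProfile u) K′⊤≤1)
  where
  r = rank M
  last = fromℕ (2 + n)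
  p = profile M F
  p′ = profile M (absorb-last F)
  module P = Profile p
  module P′ = Profile p′
  K⊤≡1 : P.K ⊤ ≡ 1
  K⊤≡1 = +-cancelˡ-≡ 2 _ _ (trans (cong (_+ P.K ⊤) (sym lc-LR≡2)) P.lc-LR)
  G-last≡2 : P.G ⁅ last ⁆ ≡ 2
  G-last≡2 = trans (sym (P.lc-QL last)) (trans (lc-comm r (Q last) L) lc-LQ≡2)
  unit : ∀ i → P.G ⁅ inject₁ i ⁆ ≡ 1 × P.K ⁅ inject₁ i ⁆ ≡ 1
  unit i = Facts.other-steps p {last} G-last≡2 K⊤≡1 (inject₁ i) (fromℕ≢inject₁ ∘ sym)
  u : UnitProfile r L (lastStep Q ∪ R) (initSteps Q)
  u = record
    { base = p′
    -- On a single step both profiles compute its local connectivity to `L`, which absorption does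
    -- not change.
    ; G≡1 = λ i → trans (sym (P′.lc-QL i)) (trans (P.lc-QL (inject₁ i)) (proj₁ (unit i)))
    ; K≡1 = λ i → trans (sym (P′.lc*-QL i)) (trans (P.lc*-QL (inject₁ i)) (proj₂ (unit i)))
    }
  2≤lc-LR′ : 2 ≤ lc r L (lastStep Q ∪ R)
  2≤lc-LR′ = ≤-trans (≤-reflexive (sym lc-LR≡2)) (lc-monoʳ r (rank-sub M) (rank-mono M) L (q⊆p∪q (lastStep Q) R))
  K′⊤≤1 : P′.K ⊤ ≤ 1
  K′⊤≤1 = m+n≤o⇒n≤o∸m (≤-trans (+-monoˡ-≤ (P′.K ⊤) 2≤lc-LR′) (≤-reflexive P′.lc-LR))

theorem5p15 : {m : ℕ} (M : Matroid m) (k : ℕ)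
    (L R : Subset m) (Q : Fin (suc k) → Subset m) →
    let r = Matroid.rank M in
    Is4cFlexipath 2 r L Q R →
    2 ≤ suc k →
    ((∀ i → ¬ SpeciallyPlacedS1 r L Q R i × ¬ SpeciallyPlacedS2 r L Q R i) →
    ((Squashed r L Q R ⊎ Stretched r L Q R ⊎ PaddleReminiscent r L Q R ⊎ SpikeReminiscent r L Q R)
    ⊎ (suc k ≡ 3 ×
    (InMOrDual PrismLike r L Q R ⊎ InMOrDual TightenedPrismLike r L Q R
    ⊎ InMOrDual DoublyTightenedPrismLike r L Q R
    ⊎ InMOrDual RelaxedSpikeReminiscent r L Q R
    ⊎ InMOrDual VamosInspired r L Q R ⊎ InMOrDual Nasty r L Q R))
    ⊎ (suc k ≡ 2 × (∀ i j → i ≢ j → PairIs r Q i j 0 0) × LRis r L R 1 1)))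
    × (SpeciallyPlacedS1 r L Q R (lastStepIx k) → 3 ≤ suc k →
    PaddleReminiscent r L (initSteps Q) (lastStep Q ∪ R)
    ⊎ RelaxedPaddleReminiscent r L (initSteps Q) (lastStep Q ∪ R))
    × (SpeciallyPlacedS2 r L Q R (lastStepIx k) → 3 ≤ suc k →
    SpikeReminiscent r L (initSteps Q) (lastStep Q ∪ R)
    ⊎ RelaxedSpikeReminiscent r L (initSteps Q) (lastStep Q ∪ R))
theorem5p15 M (suc k) L R Q paths _ =
  (λ ordinary → OrdinaryOutcome.alternatives (ordinary-outcome (profile M F) ordinary)) ,
  paddle-after-absorbing M F ,
  -- Type (S2) is type (S1) in the dual matroid, so the dual of the absorbed path is
  -- paddle-reminiscent or relaxed-paddle-reminiscent; this is translated back to `M`.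
  λ s2 3≤ → [ inj₁ ∘ Paddle-dual p′ , inj₂ ∘ RelaxedPaddle-dual p′ ]′
    (paddle-after-absorbing (dual M) (dualFlexipath M F) s2 3≤)
  where
  F = flexipath paths
  p′ = profile M (absorb-last F)
theorem5p15 M zero L R Q paths (s≤s ())
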